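{- Let $\Phi\triangleright\Gamma\vdash^{(b,e,m,f)}t:\sigma$ be a tight derivation in system $\mathscr{E}$. Then there exist $u\in\mathcal{M}$ and a head-reduction sequence $\rho: t\to_h^{(b,e,m)}u$ (containing exactly $b$ steps of kind (b), $e$ steps of kind (e) and $m$ steps of kind (m)) such that $|u|=f$.
   Context: Pair pattern calculus: patterns $p,q ::= x\mid\langle p,q\rangle$ (linear); $\mathrm{var}(p)$ = variables of $p$; $p\# q$ means disjoint variables. Terms $t,u ::= x\mid\lambda p.t\mid\langle t,u\rangle\mid t\,u\mid t[p/u]$, $\mathrm{var}(p)$ bound in $t$ in $\lambda p.t$ and $t[p/u]$; $\mathrm{fv}$ as usual; terms modulo $\alpha$. List contexts $L::=\Box\mid L[p/u]$, $L\langle t\rangle$ plugging (possibly capturing), $\mathrm{bv}(L)$ variables bound by $L$; $t\{x/u\}$ capture-avoiding substitution; $\mathrm{abs}(t)$ iff $t=L\langle\lambda p.u\rangle$. Head reduction ($t\not\to_h$: no $u$ with $t\to_h u$): (b) $L\langle\lambda p.t\rangle u\to_h L\langle t[p/u]\rangle$ if $\mathrm{bv}(L)\cap\mathrm{fv}(u)=\emptyset$; (m) $t[\langle p_1,p_2\rangle/L\langle\langle u_1,u_2\rangle\rangle]\to_h L\langle t[p_1/u_1][p_2/u_2]\rangle$ if $t\not\to_h$ and $\mathrm{bv}(L)\cap\mathrm{fv}(t)=\emptyset$; (e) $t[x/u]\to_h t\{x/u\}$ if $t\not\to_h$; closure: $\lambda p.t\to_h\lambda p.t'$ if $t\to_h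 t'$; $tu\to_h t'u$ if $t\to_h t'$ and not $\mathrm{abs}(t)$; $t[p/u]\to_h t'[p/u]$ if $t\to_h t'$; $t[p/u]\to_h t[p/u']$ if $t\not\to_h$, $p$ not a variable, $u\to_h u'$. The kind of a step is the base rule (b), (e) or (m) it uses. Canonical forms $\mathcal{M} ::= \lambda p.\mathcal{M}\mid\langle t,t\rangle\mid\mathcal{M}[\langle p_1,p_2\rangle/\mathcal{N}]\mid\mathcal{N}$, $\mathcal{N} ::= x\mid\mathcal{N}\,t\mid\mathcal{N}[\langle p_1,p_2\rangle/\mathcal{N}]$, with size $|x|=0$, $|\langle t,u\rangle|=1$, $|\mathcal{N}t|=|\mathcal{N}|+1$, $|\lambda p.\mathcal{M}|=|\mathcal{M}|+1$, $|\mathcal{M}[\langle p_1,p_2\rangle/\mathcal{N}]|=|\mathcal{M}|+|\mathcal{N}|+1$. System $\mathscr{E}$. Types: tight types $\mathtt{t} ::= \bullet_{\mathcal{N}}\mid\bullet_{\mathcal{M}}$; types $\sigma ::= \mathtt{t}\mid \mathcal{A}_1\times\mathcal{A}_2\mid \mathcal{A}\to\sigma$; multi-types $\mathcal{A} ::= [\sigma_k]_{k\in K}$ (finite, possibly empty). Contexts map variables to multi-types, $\mathrm{dom}(\Gamma)$ = variables with non-empty multi-type; $\wedge$ pointwise multiset union; $\Gamma|_p$ restriction to $\mathrm{var}(p)$; $\Gamma\setminus\mathrm{var}(p)$ removal. $\mathrm{tight}(\sigma)$ iff $\sigma\in\{\bullet_{\mathcal{N}},\bullet_{\mathcal{M}}\}$,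 extended elementwise. Rules: (pat_v) $x:\mathcal{A}\Vdash^{(1,0,0)} x:\mathcal{A}$. (pat_×) from $\Gamma\Vdash^{(e_p,m_p,f_p)}p:\mathcal{A}$, $\Delta\Vdash^{(e_q,m_q,f_q)}q:\mathcal{B}$, $p\#q$ infer $\Gamma\wedge\Delta\Vdash^{(e_p+e_q,1+m_p+m_q,f_p+f_q)}\langle p,q\rangle:[\mathcal{A}\times\mathcal{B}]$. (pat_p) if $\mathrm{dom}(\Gamma)\subseteq\mathrm{var}(\langle p,q\rangle)$ and $\mathrm{tight}(\Gamma)$ then $\Gamma\Vdash^{(0,0,1)}\langle p,q\rangle:[\bullet_{\mathcal{N}}]$. (ax) $x:[\sigma]\vdash^{(0,0,0,0)}x:\sigma$. (abs) from $\Gamma\vdash^{(b,e,m,f)}t:\sigma$ and $\Gamma|_p\Vdash^{(e_p,m_p,f_p)}p:\mathcal{A}$ infer $\Gamma\setminus\mathrm{var}(p)\vdash^{(b+1,e+e_p,m+m_p,f+f_p)}\lambda p.t:\mathcal{A}\to\sigma$. (abs_p) from $\Gamma\vdash^{(b,e,m,f)}t:\mathtt{t}$ ($\mathtt{t}$ tight) and $\mathrm{tight}(\Gamma|_p)$ infer $\Gamma\setminus\mathrm{var}(p)\vdash^{(b,e,m,f+1)}\lambda p.t:\bullet_{\mathcal{M}}$. (many) from $(\Gamma_k\vdash^{(b_k,e_k,m_k,f_k)}t:\sigma_k)_{k\in K}$ infer $\wedge_k\Gamma_k\vdash^{(\sum b_k,\sum e_k,\sum m_k,\sum f_k)}t:[\sigma_k]_{k\in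 K}$. (app) from $\Gamma\vdash^{(b_t,e_t,m_t,f_t)}t:\mathcal{A}\to\sigma$, $\Delta\vdash^{(b_u,e_u,m_u,f_u)}u:\mathcal{A}$ infer $\Gamma\wedge\Delta\vdash^{(b_t+b_u,e_t+e_u,m_t+m_u,f_t+f_u)}t\,u:\sigma$. (app_p) from $\Gamma\vdash^{(b,e,m,f)}t:\bullet_{\mathcal{N}}$ infer $\Gamma\vdash^{(b,e,m,f+1)}t\,u:\bullet_{\mathcal{N}}$. (pair) from $\Gamma\vdash^{(b_t,e_t,m_t,f_t)}t:\mathcal{A}$, $\Delta\vdash^{(b_u,e_u,m_u,f_u)}u:\mathcal{B}$ infer $\Gamma\wedge\Delta\vdash^{(b_t+b_u,e_t+e_u,m_t+m_u,f_t+f_u)}\langle t,u\rangle:\mathcal{A}\times\mathcal{B}$. (pair_p) $\vdash^{(0,0,0,1)}\langle t,u\rangle:\bullet_{\mathcal{M}}$. (match) from $\Gamma\vdash^{(b_t,e_t,m_t,f_t)}t:\sigma$, $\Gamma|_p\Vdash^{(e_p,m_p,f_p)}p:\mathcal{A}$, $\Delta\vdash^{(b_u,e_u,m_u,f_u)}u:\mathcal{A}$ infer $(\Gamma\setminus\mathrm{var}(p))\wedge\Delta\vdash^{(b_t+b_u,e_t+e_u+e_p,m_t+m_u+m_p,f_t+f_u+f_p)}t[p/u]:\sigma$. A derivation is tight if its context and its type are tight. -}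

module Defs where

open import Data.Bool using (if_then_else_)
open import Data.Empty using (⊥)
open import Data.Fin using (Fin; zero; suc; lift; _≟_)
open import Data.List using (List; []; _∷_; [_]; _++_)
open import Data.List.Relation.Binary.Permutation.Homogeneous using (Permutation)
open import Data.List.Relation.Unary.All using (All)
open import Data.Nat using (ℕ; suc; _+_)
open import Data.Product using (∃; ∃-syntax)
open import Data.Sum using (_⊎_; inj₁; inj₂; [_,_]′)
open import Data.Unit using (⊤; tt)
open import Function using (id; _∘_; const)
open import Relation.Binary.PropositionalEquality using (_≡_)
open import Relation.Nullary using (¬_; does)

------------------------------------------------------------------------
-- Terms modulo α: well-scoped de Bruijn terms.

-- A linear pattern modulo renaming is its tree shape: every leaf is a
-- distinct variable, so linearity and p # q hold by construction.
data Pat : Set where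
  pvar   : Pat
  ⟨_,_⟩ᵖ : Pat → Pat → Pat

Var : Pat → Set
Var pvar       = ⊤
Var ⟨ p , q ⟩ᵖ = Var p ⊎ Var q

infixl 6 _▹_

-- The scope n extended with the variables of a pattern, those of the left
-- component innermost; hence n ▹ ⟨ p , q ⟩ᵖ is n ▹ q ▹ p definitionally.
_▹_ : ℕ → Pat → ℕ
n ▹ pvar       = suc n
n ▹ ⟨ p , q ⟩ᵖ = n ▹ q ▹ p

wkVar : ∀ {n} p → Fin n → Fin (n ▹ p)
wkVar pvar       x = suc x
wkVar ⟨ p , q ⟩ᵖ x = wkVar p (wkVar q x)

boundVar : ∀ {n} p → Var p → Fin (n ▹ p)
boundVar pvar       tt       = zero
boundVar ⟨ p , q ⟩ᵖ (inj₁ x) = boundVar p x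
boundVar ⟨ p , q ⟩ᵖ (inj₂ y) = wkVar p (boundVar q y)

infix  9 `_
infixl 8 es
infixl 7 _·_

data Term (n : ℕ) : Set where
  `_     : Fin n → Term n
  ƛ      : (p : Pat) → Term (n ▹ p) → Term n
  ⟨_,_⟩  : Term n → Term n → Term n
  _·_    : Term n → Term n → Term n
  es     : (p : Pat) → Term (n ▹ p) → Term n → Term n

syntax es p t u = t [ p / u ]

liftRen : ∀ {m n} p → (Fin m → Fin n) → Fin (m ▹ p) → Fin (n ▹ p)
liftRen pvar       ρ = lift 1 ρ
liftRen ⟨ p , q ⟩ᵖ ρ = liftRen p (liftRen q ρ)

rename : ∀ {m n} → (Fin m → Fin n) → Term m → Term n
rename ρ (` x)         = ` ρ x
rename ρ (ƛ p t)       = ƛ p (rename (liftRen p ρ) t)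
rename ρ ⟨ t , u ⟩     = ⟨ rename ρ t , rename ρ u ⟩
rename ρ (t · u)       = rename ρ t · rename ρ u
rename ρ (t [ p / u ]) = rename (liftRen p ρ) t [ p / rename ρ u ]

liftSub : ∀ {m n} p → (Fin m → Term n) → Fin (m ▹ p) → Term (n ▹ p)
liftSub pvar       θ zero    = ` zero
liftSub pvar       θ (suc x) = rename suc (θ x)
liftSub ⟨ p , q ⟩ᵖ θ         = liftSub p (liftSub q θ)

subst : ∀ {m n} → (Fin m → Term n) → Term m → Term n
subst θ (` x)         = θ x
subst θ (ƛ p t)       = ƛ p (subst (liftSub p θ) t)
subst θ ⟨ t , u ⟩     = ⟨ subst θ t , subst θ u ⟩
subst θ (t · u)       = subst θ t · subst θ u
subst θ (t [ p / u ]) = subst (liftSub p θ) t [ p / subst θ u ]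

-- t ⟪ u ⟫ is t{x/u} for x the most recently bound variable of t.
_⟪_⟫ : ∀ {n} → Term (suc n) → Term n → Term n
_⟪_⟫ {n} t u = subst θ t
  where
  θ : Fin (suc n) → Term n
  θ zero    = u
  θ (suc x) = ` x

------------------------------------------------------------------------
-- List contexts

-- LCtx n n′ : a list context in scope n whose hole is in scope n′.
data LCtx (n : ℕ) : ℕ → Set where
  □   : LCtx n n
  les : ∀ {n′} (p : Pat) → LCtx (n ▹ p) n′ → Term n → LCtx n n′

plug : ∀ {n n′} → LCtx n n′ → Term n′ → Term n
plug □           t = t
plug (les p L u) t = plug L t [ p / u ]

syntax plug L t = L ⟪⟪ t ⟫⟫

-- Moves a variable under the binders of L.  A term renamed along throughVar L
-- has no free variable in bv(L); this is how the freshness side conditions of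
-- the rules (b) and (m) are rendered.
throughVar : ∀ {n n′} → LCtx n n′ → Fin n → Fin n′
throughVar □           = id
throughVar (les p L u) = throughVar L ∘ wkVar p

Abs : ∀ {n} → Term n → Set
Abs {n} t = ∃[ n′ ] ∃[ p ] ∃[ s ] ∃ λ (L : LCtx n n′) → t ≡ L ⟪⟪ ƛ p s ⟫⟫

------------------------------------------------------------------------
-- Head reduction

data Kind : Set where
  kb ke km : Kind

Reducts : ℕ → Set₁
Reducts n = Kind → Term n → Set

Irreducible : ∀ {n} → Reducts n → Set
Irreducible R = ¬ (∃[ k ] ∃[ v ] R k v)

-- The relation occurs negatively in its own rules, but only at immediate
-- subterms, so it is defined by recursion on the source term.  Each family
-- below lists the rules whose source has a given head constructor; R, Rₜ and
-- Rᵤ stand for the reducts of the immediate subterms.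

data LamStep {n} (p : Pat) (R : Reducts (n ▹ p)) : Reducts n where
  ξ-lam : ∀ {k t′} → R k t′ → LamStep p R k (ƛ p t′)

data AppStep {n} (t u : Term n) (R : Reducts n) : Reducts n where
  β-b   : ∀ {n′} (L : LCtx n n′) p (s : Term (n′ ▹ p)) → t ≡ L ⟪⟪ ƛ p s ⟫⟫ →
          AppStep t u R kb (L ⟪⟪ s [ p / rename (throughVar L) u ] ⟫⟫)
  ξ-app : ∀ {k t′} → R k t′ → ¬ Abs t → AppStep t u R k (t′ · u)

data VarMatchStep {n} (t : Term (n ▹ pvar)) (u : Term n)
                  (Rₜ : Reducts (n ▹ pvar)) : Reducts n where
  β-e : Irreducible Rₜ → VarMatchStep t u Rₜ ke (t ⟪ u ⟫)
  ξ-l : ∀ {k t′} → Rₜ k t′ → VarMatchStep t u Rₜ k (t′ [ pvar / u ])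

data PairMatchStep {n} (p₁ p₂ : Pat) (t : Term (n ▹ ⟨ p₁ , p₂ ⟩ᵖ)) (u : Term n)
                   (Rₜ : Reducts (n ▹ ⟨ p₁ , p₂ ⟩ᵖ)) (Rᵤ : Reducts n) : Reducts n where
  -- In t[p₁/u₁][p₂/u₂] the term u₁ lies under the binder p₂, whence wkVar p₂.
  β-m : ∀ {n′} (L : LCtx n n′) (u₁ u₂ : Term n′) → u ≡ L ⟪⟪ ⟨ u₁ , u₂ ⟩ ⟫⟫ →
        Irreducible Rₜ →
        PairMatchStep p₁ p₂ t u Rₜ Rᵤ km
          (L ⟪⟪ rename (liftRen ⟨ p₁ , p₂ ⟩ᵖ (throughVar L)) t
                  [ p₁ / rename (wkVar p₂) u₁ ] [ p₂ / u₂ ] ⟫⟫)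
  ξ-l : ∀ {k t′} → Rₜ k t′ → PairMatchStep p₁ p₂ t u Rₜ Rᵤ k (t′ [ ⟨ p₁ , p₂ ⟩ᵖ / u ])
  ξ-r : ∀ {k u′} → Irreducible Rₜ → Rᵤ k u′ →
        PairMatchStep p₁ p₂ t u Rₜ Rᵤ k (t [ ⟨ p₁ , p₂ ⟩ᵖ / u′ ])

infix 4 _⟶⟨_⟩_

_⟶⟨_⟩_ : ∀ {n} → Term n → Kind → Term n → Set
(` x)                    ⟶⟨ k ⟩ v = ⊥
ƛ p t                    ⟶⟨ k ⟩ v = LamStep p (λ k′ t′ → t ⟶⟨ k′ ⟩ t′) k v
⟨ t , u ⟩                ⟶⟨ k ⟩ v = ⊥
(t · u)                  ⟶⟨ k ⟩ v = AppStep t u (λ k′ t′ → t ⟶⟨ k′ ⟩ t′) k v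
(t [ pvar / u ])         ⟶⟨ k ⟩ v = VarMatchStep t u (λ k′ t′ → t ⟶⟨ k′ ⟩ t′) k v
(t [ ⟨ p₁ , p₂ ⟩ᵖ / u ]) ⟶⟨ k ⟩ v =
  PairMatchStep p₁ p₂ t u (λ k′ t′ → t ⟶⟨ k′ ⟩ t′) (λ k′ u′ → u ⟶⟨ k′ ⟩ u′) k v

infix 4 _↠⟨_,_,_⟩_

-- t ↠⟨ b , e , m ⟩ u : a head-reduction sequence with exactly b, e and m steps
-- of the kinds (b), (e) and (m) respectively.
data _↠⟨_,_,_⟩_ {n} : Term n → ℕ → ℕ → ℕ → Term n → Set where
  done   : ∀ {t} → t ↠⟨ 0 , 0 , 0 ⟩ t
  step-b : ∀ {t s u b e m} → t ⟶⟨ kb ⟩ s → s ↠⟨ b , e , m ⟩ u → t ↠⟨ suc b , e , m ⟩ u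
  step-e : ∀ {t s u b e m} → t ⟶⟨ ke ⟩ s → s ↠⟨ b , e , m ⟩ u → t ↠⟨ b , suc e , m ⟩ u
  step-m : ∀ {t s u b e m} → t ⟶⟨ km ⟩ s → s ↠⟨ b , e , m ⟩ u → t ↠⟨ b , e , suc m ⟩ u

------------------------------------------------------------------------
-- Canonical forms

data 𝓝 {n} : Term n → Set where
  var   : ∀ {x} → 𝓝 (` x)
  app   : ∀ {t u} → 𝓝 t → 𝓝 (t · u)
  match : ∀ {p₁ p₂ t u} → 𝓝 t → 𝓝 u → 𝓝 (t [ ⟨ p₁ , p₂ ⟩ᵖ / u ])

data 𝓜 {n} : Term n → Set where
  lam     : ∀ {p t} → 𝓜 t → 𝓜 (ƛ p t)
  pair    : ∀ {t u} → 𝓜 ⟨ t , u ⟩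
  match   : ∀ {p₁ p₂ t u} → 𝓜 t → 𝓝 u → 𝓜 (t [ ⟨ p₁ , p₂ ⟩ᵖ / u ])
  neutral : ∀ {t} → 𝓝 t → 𝓜 t

-- Total on terms for convenience; meaningful on canonical forms only, which
-- (outside pair components and arguments) contain no subterm t[x/u].
∣_∣ : ∀ {n} → Term n → ℕ
∣ ` x ∣         = 0
∣ ƛ p t ∣       = ∣ t ∣ + 1
∣ ⟨ t , u ⟩ ∣   = 1
∣ t · u ∣       = ∣ t ∣ + 1
∣ t [ p / u ] ∣ = ∣ t ∣ + ∣ u ∣ + 1

------------------------------------------------------------------------
-- Types

data TightTy : Set where
  •𝓝 •𝓜 : TightTy

infixr 6 _⇒_
infix  7 _⊗_

mutual
  data Ty : Set where
    tight : TightTy → Ty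
    _⊗_   : MTy → MTy → Ty
    _⇒_   : MTy → Ty → Ty

  -- Finite multisets, represented by lists and compared with _≋_ below.
  MTy : Set
  MTy = List Ty

infix 4 _≃_ _≋_ _≅_

-- Equality of types, with multi-types compared as multisets at every depth.
mutual
  data _≃_ : Ty → Ty → Set where
    tight : ∀ {τ} → tight τ ≃ tight τ
    _⊗_   : ∀ {A A′ B B′} → A ≋ A′ → B ≋ B′ → (A ⊗ B) ≃ (A′ ⊗ B′)
    _⇒_   : ∀ {A A′ σ σ′} → A ≋ A′ → σ ≃ σ′ → (A ⇒ σ) ≃ (A′ ⇒ σ′)

  _≋_ : MTy → MTy → Set
  _≋_ = Permutation _≃_

data Tight : Ty → Set where
  tight : ∀ τ → Tight (tight τ)

------------------------------------------------------------------------
-- Typing contexts.  X is Fin n for terms in scope n, and Var p for patterns.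

Ctx : Set → Set
Ctx X = X → MTy

_≅_ : ∀ {X} → Ctx X → Ctx X → Set
Γ ≅ Δ = ∀ x → Γ x ≋ Δ x

TightCtx : ∀ {X} → Ctx X → Set
TightCtx Γ = ∀ x → All Tight (Γ x)

∅ : ∀ {X} → Ctx X
∅ _ = []

infixl 5 _∧_

_∧_ : ∀ {X} → Ctx X → Ctx X → Ctx X
(Γ ∧ Δ) x = Γ x ++ Δ x

_∶[_] : ∀ {n} → Fin n → Ty → Ctx (Fin n)
(x ∶[ σ ]) y = if does (x ≟ y) then [ σ ] else []

restrict : ∀ {n} p → Ctx (Fin (n ▹ p)) → Ctx (Var p)
restrict p Γ = Γ ∘ boundVar p

remove : ∀ {n} p → Ctx (Fin (n ▹ p)) → Ctx (Fin n)
remove p Γ = Γ ∘ wkVar p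

infixl 6 restrict remove

syntax restrict p Γ = Γ ∣ p
syntax remove   p Γ = Γ ∖ p

------------------------------------------------------------------------
-- System 𝓔.  Since types are compared up to _≃_, each judgement is closed
-- under replacing its context and its type by equal ones (rules conv), at no
-- cost in the counters.

infix 3 PatTyping _⊢⟨_,_,_,_⟩_∶_ _⊢*⟨_,_,_,_⟩_∶_

data PatTyping : (p : Pat) → Ctx (Var p) → ℕ → ℕ → ℕ → MTy → Set

syntax PatTyping p Γ e m f A = Γ ⊩⟨ e , m , f ⟩ p ∶ A

data PatTyping where
  pat-v : ∀ {A} → const A ⊩⟨ 1 , 0 , 0 ⟩ pvar ∶ A
  -- Γ ∧ Δ is the copairing because p and q have disjoint variables.
  pat-× : ∀ {p q Γ Δ A B eₚ mₚ fₚ e′ m′ f′} →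
          Γ ⊩⟨ eₚ , mₚ , fₚ ⟩ p ∶ A →
          Δ ⊩⟨ e′ , m′ , f′ ⟩ q ∶ B →
          [ Γ , Δ ]′ ⊩⟨ eₚ + e′ , 1 + mₚ + m′ , fₚ + f′ ⟩ ⟨ p , q ⟩ᵖ ∶ [ A ⊗ B ]
  pat-p : ∀ {p q Γ} → TightCtx Γ →
          Γ ⊩⟨ 0 , 0 , 1 ⟩ ⟨ p , q ⟩ᵖ ∶ [ tight •𝓝 ]
  conv  : ∀ {p Γ Γ′ A A′ e m f} → Γ ≅ Γ′ → A ≋ A′ →
          Γ ⊩⟨ e , m , f ⟩ p ∶ A → Γ′ ⊩⟨ e , m , f ⟩ p ∶ A′

mutual
  data _⊢⟨_,_,_,_⟩_∶_ {n} : Ctx (Fin n) → ℕ → ℕ → ℕ → ℕ → Term n → Ty → Set where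
    ax     : ∀ {x σ} → x ∶[ σ ] ⊢⟨ 0 , 0 , 0 , 0 ⟩ ` x ∶ σ
    abs    : ∀ {p Γ t σ A b e m f eₚ mₚ fₚ} →
             Γ ⊢⟨ b , e , m , f ⟩ t ∶ σ →
             Γ ∣ p ⊩⟨ eₚ , mₚ , fₚ ⟩ p ∶ A →
             Γ ∖ p ⊢⟨ b + 1 , e + eₚ , m + mₚ , f + fₚ ⟩ ƛ p t ∶ A ⇒ σ
    abs-p  : ∀ {p Γ t τ b e m f} →
             Γ ⊢⟨ b , e , m , f ⟩ t ∶ tight τ →
             TightCtx (Γ ∣ p) →
             Γ ∖ p ⊢⟨ b , e , m , f + 1 ⟩ ƛ p t ∶ tight •𝓜
    app    : ∀ {Γ Δ t u A σ bₜ eₜ mₜ fₜ bᵤ eᵤ mᵤ fᵤ} →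
             Γ ⊢⟨ bₜ , eₜ , mₜ , fₜ ⟩ t ∶ A ⇒ σ →
             Δ ⊢*⟨ bᵤ , eᵤ , mᵤ , fᵤ ⟩ u ∶ A →
             Γ ∧ Δ ⊢⟨ bₜ + bᵤ , eₜ + eᵤ , mₜ + mᵤ , fₜ + fᵤ ⟩ t · u ∶ σ
    app-p  : ∀ {Γ t u b e m f} →
             Γ ⊢⟨ b , e , m , f ⟩ t ∶ tight •𝓝 →
             Γ ⊢⟨ b , e , m , f + 1 ⟩ t · u ∶ tight •𝓝
    pair   : ∀ {Γ Δ t u A B bₜ eₜ mₜ fₜ bᵤ eᵤ mᵤ fᵤ} →
             Γ ⊢*⟨ bₜ , eₜ , mₜ , fₜ ⟩ t ∶ A →
             Δ ⊢*⟨ bᵤ , eᵤ , mᵤ , fᵤ ⟩ u ∶ B →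
             Γ ∧ Δ ⊢⟨ bₜ + bᵤ , eₜ + eᵤ , mₜ + mᵤ , fₜ + fᵤ ⟩ ⟨ t , u ⟩ ∶ A ⊗ B
    pair-p : ∀ {t u} → ∅ ⊢⟨ 0 , 0 , 0 , 1 ⟩ ⟨ t , u ⟩ ∶ tight •𝓜
    match  : ∀ {p Γ Δ t u A σ bₜ eₜ mₜ fₜ eₚ mₚ fₚ bᵤ eᵤ mᵤ fᵤ} →
             Γ ⊢⟨ bₜ , eₜ , mₜ , fₜ ⟩ t ∶ σ →
             Γ ∣ p ⊩⟨ eₚ , mₚ , fₚ ⟩ p ∶ A →
             Δ ⊢*⟨ bᵤ , eᵤ , mᵤ , fᵤ ⟩ u ∶ A →
             (Γ ∖ p) ∧ Δ ⊢⟨ bₜ + bᵤ , eₜ + eᵤ + eₚ , mₜ + mᵤ + mₚ , fₜ + fᵤ + fₚ ⟩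
               t [ p / u ] ∶ σ
    conv   : ∀ {Γ Γ′ t σ σ′ b e m f} → Γ ≅ Γ′ → σ ≃ σ′ →
             Γ ⊢⟨ b , e , m , f ⟩ t ∶ σ → Γ′ ⊢⟨ b , e , m , f ⟩ t ∶ σ′

  -- The rule (many), its finite family of premises being given one at a time.
  data _⊢*⟨_,_,_,_⟩_∶_ {n} : Ctx (Fin n) → ℕ → ℕ → ℕ → ℕ → Term n → MTy → Set where
    many-[] : ∀ {t} → ∅ ⊢*⟨ 0 , 0 , 0 , 0 ⟩ t ∶ []
    many-∷  : ∀ {Γ Δ t σ A b e m f b′ e′ m′ f′} →
              Γ ⊢⟨ b , e , m , f ⟩ t ∶ σ →
              Δ ⊢*⟨ b′ , e′ , m′ , f′ ⟩ t ∶ A →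
              Γ ∧ Δ ⊢*⟨ b + b′ , e + e′ , m + m′ , f + f′ ⟩ t ∶ σ ∷ A
    conv    : ∀ {Γ Γ′ t A A′ b e m f} → Γ ≅ Γ′ → A ≋ A′ →
              Γ ⊢*⟨ b , e , m , f ⟩ t ∶ A → Γ′ ⊢*⟨ b , e , m , f ⟩ t ∶ A′

{-# OPTIONS --safe #-}

-- Subject reduction holds for arbitrary derivations with exact counters: head
-- reduction acts only on subterms that are typed exactly once, so a step of kind
-- k lowers the counter of k by one and leaves the context, the type and the other
-- counters unchanged.  A typed term is canonical or reduces, whence after exactly
-- b + e + m steps a canonical form is reached.  If it is tightly typed, tightness
-- of the context spreads to the types of neutral subterms; hence only the
-- persistent rules can occur, which count the size and nothing else.
module Submission where

open import Defs
open import Algebra using (CommutativeMonoid)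
import Algebra.Construct.Pointwise as Pointwise
import Algebra.Properties.CommutativeSemigroup as CommutativeSemigroupProperties
import Algebra.Solver.CommutativeMonoid as Solver
open import Data.Bool using (true; false)
open import Data.Empty using (⊥-elim)
open import Data.Fin using (Fin; zero; suc; _≟_)
open import Data.List using ([]; _∷_; [_]; _++_)
open import Data.List.Relation.Binary.Permutation.Homogeneous using (refl; prep; swap; trans)
import Data.List.Relation.Binary.Permutation.Setoid.Properties as PermProperties
open import Data.List.Relation.Binary.Pointwise using ([]; _∷_) renaming (Pointwise to ListPointwise)
open import Data.List.Relation.Unary.All using ([]; _∷_)
open import Data.List.Relation.Unary.All.Properties using (++⁻ˡ; ++⁻ʳ)
open import Data.Maybe using (Maybe; just; nothing; map; maybe′; _>>=_)
open import Data.Maybe.Properties using (map-∘)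
open import Data.Nat using (ℕ; zero; suc; _+_)
open import Data.Nat.Properties using (+-0-commutativeMonoid; +-assoc; +-comm; +-commutativeSemigroup; +-identityʳ; +-suc; suc-injective)
open import Data.Product using (_×_; _,_; ∃-syntax; Σ-syntax; proj₂)
open import Data.Sum using (_⊎_; inj₁; inj₂)
open import Data.Unit using (tt)
open import Function using (_∘_; const)
open import Relation.Binary using (Setoid)
open import Relation.Binary.PropositionalEquality using (_≡_; cong; cong₂) renaming (refl to ≡-refl; sym to ≡-sym; trans to ≡-trans)
open import Relation.Nullary using (¬_; Dec; yes; no; does)

-- Equality of types

-- The rules `conv` may occur anywhere in a derivation of system 𝓔 and block inversion. The variant
-- below builds them into the other rules: each states its resource up to an equation, so that
-- matching on a derivation yields its premises at once. Contexts and counters are split and merged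
-- in the same places, and are therefore bundled into one commutative monoid. Every unit of a step
-- counter is stored in the rule that the step destroys: `abs` for (b), a variable pattern for (e),
-- a pair pattern for (m). Nothing else gets lost, because derivations are never copied. A pair
-- pattern has a one-element multi-type, so what is matched against it has one derivation; the
-- argument of (e) may have many or none, but these are dealt out to the typed occurrences of the
-- variable. The negative premises of head reduction shape progress: firing a rule may require an
-- irreducible body, so canonical forms are shown irreducible, and clashes such as a pair in
-- function position are refuted by typing.

mutual
  ≃-refl : ∀ {σ} → σ ≃ σ
  ≃-refl {tight τ} = tight
  ≃-refl {A ⊗ B}   = refl ≋-pointwise ⊗ refl ≋-pointwise
  ≃-refl {A ⇒ σ}   = refl ≋-pointwise ⇒ ≃-refl

  ≋-pointwise : ∀ {A} → ListPointwise _≃_ A A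
  ≋-pointwise {[]}    = []
  ≋-pointwise {σ ∷ A} = ≃-refl ∷ ≋-pointwise

mutual
  ≃-sym : ∀ {σ τ} → σ ≃ τ → τ ≃ σ
  ≃-sym tight   = tight
  ≃-sym (a ⊗ b) = ≋-sym a ⊗ ≋-sym b
  ≃-sym (a ⇒ s) = ≋-sym a ⇒ ≃-sym s

  ≋-sym : ∀ {A B} → A ≋ B → B ≋ A
  ≋-sym (refl ss)    = refl (pointwise-sym ss)
  ≋-sym (prep s a)   = prep (≃-sym s) (≋-sym a)
  ≋-sym (swap s t a) = swap (≃-sym t) (≃-sym s) (≋-sym a)
  ≋-sym (trans a b)  = trans (≋-sym b) (≋-sym a)

  pointwise-sym : ∀ {A B} → ListPointwise _≃_ A B → ListPointwise _≃_ B A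
  pointwise-sym []       = []
  pointwise-sym (s ∷ ss) = ≃-sym s ∷ pointwise-sym ss

≃-trans : ∀ {ρ σ τ} → ρ ≃ σ → σ ≃ τ → ρ ≃ τ
≃-trans tight   tight     = tight
≃-trans (a ⊗ b) (a′ ⊗ b′) = trans a a′ ⊗ trans b b′
≃-trans (a ⇒ s) (a′ ⇒ s′) = trans a a′ ⇒ ≃-trans s s′

≃-setoid : Setoid _ _
≃-setoid = record
  { Carrier       = Ty
  ; _≈_           = _≃_
  ; isEquivalence = record { refl = ≃-refl ; sym = ≃-sym ; trans = ≃-trans }
  }

module Perm = PermProperties ≃-setoid

≋-refl : ∀ {A} → A ≋ A
≋-refl = refl ≋-pointwise

-- Contexts together with counters

-- Indexing the counters by `Tick` turns the four arithmetic side conditions of a typing rule into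
-- one pointwise equation.
data Tick : Set where
  step : Kind → Tick
  size : Tick

Count : Set
Count = Tick → ℕ

counts : ℕ → ℕ → ℕ → ℕ → Count
counts b e m f (step kb) = b
counts b e m f (step ke) = e
counts b e m f (step km) = m
counts b e m f size      = f

tick : Tick → Count
tick (step kb) = counts 1 0 0 0
tick (step ke) = counts 0 1 0 0
tick (step km) = counts 0 0 1 0
tick size      = counts 0 0 0 1

-- Without η, unification recovers r and s from r ∙ s.
record Resource (X : Set) : Set where
  no-eta-equality
  constructor _,_
  field
    ctx : Ctx X
    cnt : Count

open Resource

infix 4 _≈_

record _≈_ {X} (r s : Resource X) : Set where
  no-eta-equality
  constructor _,_
  field
    ctx-≈ : ctx r ≅ ctx s
    cnt-≈ : ∀ i → cnt r i ≡ cnt s i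

open _≈_

private
  module Ctxs {X : Set} = CommutativeMonoid (Pointwise.commutativeMonoid X Perm.++-commutativeMonoid)
  module Counts   = CommutativeMonoid (Pointwise.commutativeMonoid Tick +-0-commutativeMonoid)

infixl 6 _⊕_

_⊕_ : Count → Count → Count
(c ⊕ d) i = c i + d i

infixr 6 _∙_

_∙_ : ∀ {X} → Resource X → Resource X → Resource X
ctx (r ∙ s) = ctx r ∧ ctx s
cnt (r ∙ s) = cnt r ⊕ cnt s

-- Puts the charge of a rule or a pattern into the same monoid as the resources of derivations, so
-- that one rearrangement moves both.
cost : ∀ {X} → Count → Resource X
ctx (cost c) = ∅
cnt (cost c) = c

ε : ∀ {X} → Resource X
ε = cost (const 0)

resources : Set → CommutativeMonoid _ _
resources X = record
  { Carrier = Resource X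
  ; _≈_     = _≈_
  ; _∙_     = _∙_
  ; ε       = ε
  ; isCommutativeMonoid = record
    { isMonoid = record
      { isSemigroup = record
        { isMagma = record
          { isEquivalence = record
            { refl  = Ctxs.refl , Counts.refl
            ; sym   = λ p → Ctxs.sym (ctx-≈ p) , Counts.sym (cnt-≈ p)
            ; trans = λ p q → Ctxs.trans (ctx-≈ p) (ctx-≈ q) , Counts.trans (cnt-≈ p) (cnt-≈ q)
            }
          ; ∙-cong = λ p q → Ctxs.∙-cong (ctx-≈ p) (ctx-≈ q) , Counts.∙-cong (cnt-≈ p) (cnt-≈ q)
          }
        ; assoc = λ r s t → Ctxs.assoc (ctx r) (ctx s) (ctx t) , Counts.assoc (cnt r) (cnt s) (cnt t)
        }
      ; identity = (λ r → Ctxs.identityˡ (ctx r) , Counts.identityˡ (cnt r))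
                 , (λ r → Ctxs.identityʳ (ctx r) , Counts.identityʳ (cnt r))
      }
    ; comm = λ r s → Ctxs.comm (ctx r) (ctx s) , Counts.comm (cnt r) (cnt s)
    }
  }

private
  module Res {X : Set} = CommutativeMonoid (resources X)
  module ResSemigroup {X : Set} = CommutativeSemigroupProperties (Res.commutativeSemigroup {X})

open Res using (∙-cong; ∙-congˡ; ∙-congʳ; assoc; comm; identityˡ; identityʳ)
  renaming (refl to ≈-refl; sym to ≈-sym; trans to ≈-trans)
open ResSemigroup using (interchange; x∙yz≈y∙xz)

drop : ∀ {n} p → Resource (Fin (n ▹ p)) → Resource (Fin n)
ctx (drop p r) = ctx r ∖ p
cnt (drop p r) = cnt r

drop-cong : ∀ {n} p {r s : Resource (Fin (n ▹ p))} → r ≈ s → drop p r ≈ drop p s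
drop-cong p eq = ctx-≈ eq ∘ wkVar p , cnt-≈ eq

-- Syntax-directed typing

infix 3 PatternTyping _⊢_∶_ _⊢*_∶_

-- The charge of a pattern announces its fate: a variable awaits one (e) step, a pair typed by
-- `pat-×` one (m) step, and a pair typed by `pat-p` is never matched and counts towards the size
-- instead.
data PatternTyping : (p : Pat) → Ctx (Var p) → Count → MTy → Set

syntax PatternTyping p Γ c A = Γ ⊩[ c ] p ∶ A

data PatternTyping where
  pat-v : ∀ {Γ A} → Γ tt ≋ A → Γ ⊩[ tick (step ke) ] pvar ∶ A
  pat-× : ∀ {p q Γ A B C c d} →
          Γ ∘ inj₁ ⊩[ c ] p ∶ A → Γ ∘ inj₂ ⊩[ d ] q ∶ B → [ A ⊗ B ] ≋ C →
          Γ ⊩[ tick (step km) ⊕ (c ⊕ d) ] ⟨ p , q ⟩ᵖ ∶ C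
  pat-p : ∀ {p q Γ C} → TightCtx Γ → [ tight •𝓝 ] ≋ C →
          Γ ⊩[ tick size ] ⟨ p , q ⟩ᵖ ∶ C

-- A syntax-directed variant of system 𝓔: contexts and counters are compared up
-- to _≈_ in every rule, and the rule conv is admissible.
mutual
  data _⊢_∶_ {n} (r : Resource (Fin n)) : Term n → Ty → Set where
    ax     : ∀ {x σ} → r ≈ (x ∶[ σ ] , const 0) → r ⊢ ` x ∶ σ
    abs    : ∀ {p s t σ τ A c} →
             s ⊢ t ∶ σ → ctx s ∣ p ⊩[ c ] p ∶ A →
             r ≈ cost (c ⊕ tick (step kb)) ∙ drop p s → A ⇒ σ ≃ τ → r ⊢ ƛ p t ∶ τ
    abs-p  : ∀ {p s t τ} →
             s ⊢ t ∶ tight τ → TightCtx (ctx s ∣ p) →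
             r ≈ cost (tick size) ∙ drop p s → r ⊢ ƛ p t ∶ tight •𝓜
    app    : ∀ {s s′ t u σ A} →
             s ⊢ t ∶ A ⇒ σ → s′ ⊢* u ∶ A → r ≈ s ∙ s′ → r ⊢ t · u ∶ σ
    app-p  : ∀ {s t u} →
             s ⊢ t ∶ tight •𝓝 → r ≈ cost (tick size) ∙ s → r ⊢ t · u ∶ tight •𝓝
    pair   : ∀ {s s′ t u A B τ} →
             s ⊢* t ∶ A → s′ ⊢* u ∶ B → r ≈ s ∙ s′ → A ⊗ B ≃ τ → r ⊢ ⟨ t , u ⟩ ∶ τ
    pair-p : ∀ {t u} → r ≈ cost (tick size) → r ⊢ ⟨ t , u ⟩ ∶ tight •𝓜
    match  : ∀ {p s s′ t u σ A c} →
             s ⊢ t ∶ σ → ctx s ∣ p ⊩[ c ] p ∶ A → s′ ⊢* u ∶ A →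
             r ≈ cost c ∙ (drop p s ∙ s′) → r ⊢ t [ p / u ] ∶ σ

  data _⊢*_∶_ {n} (r : Resource (Fin n)) (t : Term n) : MTy → Set where
    nil  : r ≈ ε → r ⊢* t ∶ []
    cons : ∀ {s s′ σ A} → s ⊢ t ∶ σ → s′ ⊢* t ∶ A → r ≈ s ∙ s′ → r ⊢* t ∶ σ ∷ A

private
  variable
    m n       : ℕ
    r s s′    : Resource (Fin n)
    t u       : Term n
    σ τ       : Ty
    A B       : MTy

singleton-cong : ∀ (x : Fin n) → σ ≃ τ → x ∶[ σ ] ≅ x ∶[ τ ]
singleton-cong x eq y with does (x ≟ y)
... | true  = refl (eq ∷ [])
... | false = ≋-refl

≈-conv : r ≈ s → s ⊢ t ∶ σ → r ⊢ t ∶ σ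
≈-conv eq (ax eq′)            = ax (≈-trans eq eq′)
≈-conv eq (abs d π eq′ ty)    = abs d π (≈-trans eq eq′) ty
≈-conv eq (abs-p d tgt eq′)   = abs-p d tgt (≈-trans eq eq′)
≈-conv eq (app d d′ eq′)      = app d d′ (≈-trans eq eq′)
≈-conv eq (app-p d eq′)       = app-p d (≈-trans eq eq′)
≈-conv eq (pair d d′ eq′ ty)  = pair d d′ (≈-trans eq eq′) ty
≈-conv eq (pair-p eq′)        = pair-p (≈-trans eq eq′)
≈-conv eq (match d π d′ eq′)  = match d π d′ (≈-trans eq eq′)

≈-conv* : r ≈ s → s ⊢* t ∶ A → r ⊢* t ∶ A
≈-conv* eq (nil eq′)       = nil (≈-trans eq eq′)
≈-conv* eq (cons d ds eq′) = cons d ds (≈-trans eq eq′)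

≃-conv : σ ≃ τ → r ⊢ t ∶ σ → r ⊢ t ∶ τ
≃-conv eq    (ax {x} eq′)       = ax (≈-trans eq′ (singleton-cong x eq , λ _ → ≡-refl))
≃-conv eq    (abs d π eq′ ty)   = abs d π eq′ (≃-trans ty eq)
≃-conv tight (abs-p d tgt eq′)  = abs-p d tgt eq′
≃-conv eq    (app d d′ eq′)     = app (≃-conv (≋-refl ⇒ eq) d) d′ eq′
≃-conv tight (app-p d eq′)      = app-p d eq′
≃-conv eq    (pair d d′ eq′ ty) = pair d d′ eq′ (≃-trans ty eq)
≃-conv tight (pair-p eq′)       = pair-p eq′
≃-conv eq    (match d π d′ eq′) = match (≃-conv eq d) π d′ eq′

≋-conv* : A ≋ B → r ⊢* t ∶ A → r ⊢* t ∶ B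
≋-conv* (refl [])          ds              = ds
≋-conv* (refl (eq ∷ eqs))  (cons d ds eq′) = cons (≃-conv eq d) (≋-conv* (refl eqs) ds) eq′
≋-conv* (prep eq eqs)      (cons d ds eq′) = cons (≃-conv eq d) (≋-conv* eqs ds) eq′
≋-conv* (swap eq₁ eq₂ eqs) (cons d₁ (cons d₂ ds eq″) eq′) =
  cons (≃-conv eq₂ d₂) (cons (≃-conv eq₁ d₁) (≋-conv* eqs ds) ≈-refl)
    (≈-trans eq′ (≈-trans (∙-congˡ eq″) (x∙yz≈y∙xz _ _ _)))
≋-conv* (trans eqs eqs′)   ds              = ≋-conv* eqs′ (≋-conv* eqs ds)

tight-resp : σ ≃ τ → Tight σ → Tight τ
tight-resp tight (tight τ) = tight τ

tightCtx-resp : ∀ {X} {Γ Δ : Ctx X} → Γ ≅ Δ → TightCtx Γ → TightCtx Δ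
tightCtx-resp eq tgt x = Perm.All-resp-↭ tight-resp (eq x) (tgt x)

pattern-conv : ∀ {p Γ Δ c} → Γ ≅ Δ → A ≋ B → Γ ⊩[ c ] p ∶ A → Δ ⊩[ c ] p ∶ B
pattern-conv eq eq′ (pat-v e)       = pat-v (trans (≋-sym (eq tt)) (trans e eq′))
pattern-conv eq eq′ (pat-× π π′ e)  =
  pat-× (pattern-conv (eq ∘ inj₁) ≋-refl π) (pattern-conv (eq ∘ inj₂) ≋-refl π′) (trans e eq′)
pattern-conv eq eq′ (pat-p tgt e)   = pat-p (tightCtx-resp eq tgt) (trans e eq′)

≡⇒≋ : A ≡ B → A ≋ B
≡⇒≋ ≡-refl = ≋-refl

-- Translation from system 𝓔 into the syntax-directed variant

translate-pattern : ∀ {p Γ e m f A} → Γ ⊩⟨ e , m , f ⟩ p ∶ A →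
                    ∃[ c ] (∀ i → counts 0 e m f i ≡ c i) × (Γ ⊩[ c ] p ∶ A)
-- The count found agrees with `counts 0 e m f` pointwise but need not be the same function, hence
-- the separate witness. The leading 0 is there because patterns carry no (b) counter.
translate-pattern pat-v        = _ , (λ _ → ≡-refl) , pat-v ≋-refl
translate-pattern (pat-× π π′) with translate-pattern π | translate-pattern π′
... | c , eq , κ | c′ , eq′ , κ′ = _ , eq″ , pat-× κ κ′ ≋-refl
  where
  eq″ : ∀ i → _ ≡ (tick (step km) ⊕ (c ⊕ c′)) i
  eq″ (step kb) = cong₂ _+_ (eq (step kb)) (eq′ (step kb))
  eq″ (step ke) = cong₂ _+_ (eq (step ke)) (eq′ (step ke))
  eq″ (step km) = cong suc (cong₂ _+_ (eq (step km)) (eq′ (step km)))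
  eq″ size      = cong₂ _+_ (eq size) (eq′ size)
translate-pattern (pat-p tgt)  = _ , (λ _ → ≡-refl) , pat-p tgt ≋-refl
translate-pattern (conv eq eq′ π) with translate-pattern π
... | c , e , κ = c , e , pattern-conv eq eq′ κ

counts-+ : ∀ b e m f {b′ e′ m′ f′} i →
           counts (b + b′) (e + e′) (m + m′) (f + f′) i ≡ (counts b e m f ⊕ counts b′ e′ m′ f′) i
counts-+ b e m f (step kb) = ≡-refl
counts-+ b e m f (step ke) = ≡-refl
counts-+ b e m f (step km) = ≡-refl
counts-+ b e m f size      = ≡-refl

counts-abs : ∀ b e m f eₚ mₚ fₚ {c} → (∀ i → counts 0 eₚ mₚ fₚ i ≡ c i) → ∀ i →
             counts (b + 1) (e + eₚ) (m + mₚ) (f + fₚ) i ≡ (c ⊕ tick (step kb) ⊕ counts b e m f) i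
counts-abs b e m f eₚ mₚ fₚ eq i rewrite ≡-sym (eq i) with i
... | step kb = +-comm b 1
... | step ke = ≡-trans (+-comm e eₚ) (cong (_+ e) (≡-sym (+-identityʳ eₚ)))
... | step km = ≡-trans (+-comm m mₚ) (cong (_+ m) (≡-sym (+-identityʳ mₚ)))
... | size    = ≡-trans (+-comm f fₚ) (cong (_+ f) (≡-sym (+-identityʳ fₚ)))

counts-size : ∀ b e m f i → counts b e m (f + 1) i ≡ (tick size ⊕ counts b e m f) i
counts-size b e m f (step kb) = ≡-refl
counts-size b e m f (step ke) = ≡-refl
counts-size b e m f (step km) = ≡-refl
counts-size b e m f size      = +-comm f 1

counts-match : ∀ b e m f b′ e′ m′ f′ eₚ mₚ fₚ {c} → (∀ i → counts 0 eₚ mₚ fₚ i ≡ c i) → ∀ i →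
               counts (b + b′) (e + e′ + eₚ) (m + m′ + mₚ) (f + f′ + fₚ) i ≡
               (c ⊕ (counts b e m f ⊕ counts b′ e′ m′ f′)) i
counts-match b e m f b′ e′ m′ f′ eₚ mₚ fₚ eq i rewrite ≡-sym (eq i) with i
... | step kb = ≡-refl
... | step ke = +-comm (e + e′) eₚ
... | step km = +-comm (m + m′) mₚ
... | size    = +-comm (f + f′) fₚ

mutual
  translate : ∀ {Γ : Ctx (Fin n)} {b e m f} → Γ ⊢⟨ b , e , m , f ⟩ t ∶ σ → (Γ , counts b e m f) ⊢ t ∶ σ
  translate ax = ax ((λ _ → ≋-refl) , λ where
    (step kb) → ≡-refl
    (step ke) → ≡-refl
    (step km) → ≡-refl
    size      → ≡-refl)
  translate (abs {b = b} {e} {m} {f} {eₚ} {mₚ} {fₚ} d π) with translate-pattern π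
  ... | c , eq , κ =
    abs (translate d) κ ((λ _ → ≋-refl) , counts-abs b e m f eₚ mₚ fₚ eq) ≃-refl
  translate (abs-p {b = b} {e} {m} {f} d tgt) =
    abs-p (translate d) tgt ((λ _ → ≋-refl) , counts-size b e m f)
  translate (app {bₜ = b} {e} {m} {f} d d′) =
    app (translate d) (translate* d′) ((λ _ → ≋-refl) , counts-+ b e m f)
  translate (app-p {b = b} {e} {m} {f} d) =
    app-p (translate d) ((λ _ → ≋-refl) , counts-size b e m f)
  translate (pair {bₜ = b} {e} {m} {f} d d′) =
    pair (translate* d) (translate* d′) ((λ _ → ≋-refl) , counts-+ b e m f) ≃-refl
  translate pair-p = pair-p ((λ _ → ≋-refl) , λ _ → ≡-refl)
  translate (match {bₜ = b} {e} {m} {f} {eₚ} {mₚ} {fₚ} {b′} {e′} {m′} {f′} d π d′) with translate-pattern π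
  ... | c , eq , κ =
    match (translate d) κ (translate* d′) ((λ _ → ≋-refl) , counts-match b e m f b′ e′ m′ f′ eₚ mₚ fₚ eq)
  translate (conv eq eq′ d) = ≃-conv eq′ (≈-conv ((≋-sym ∘ eq) , λ _ → ≡-refl) (translate d))

  translate* : ∀ {Γ : Ctx (Fin n)} {b e m f} → Γ ⊢*⟨ b , e , m , f ⟩ t ∶ A → (Γ , counts b e m f) ⊢* t ∶ A
  translate* many-[] = nil ((λ _ → ≋-refl) , λ where
    (step kb) → ≡-refl
    (step ke) → ≡-refl
    (step km) → ≡-refl
    size      → ≡-refl)
  translate* (many-∷ {b = b} {e} {m} {f} d ds) =
    cons (translate d) (translate* ds) ((λ _ → ≋-refl) , counts-+ b e m f)
  translate* (conv eq eq′ ds) = ≋-conv* eq′ (≈-conv* ((≋-sym ∘ eq) , λ _ → ≡-refl) (translate* ds))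

-- Renaming

-- Along a renaming, a context is transported by looking up preimages: `π` is a partial inverse of
-- the renaming, and variables outside its image get the empty multi-type.
push : ∀ {X Y} → (Y → Maybe X) → Resource X → Resource Y
ctx (push π r) = maybe′ (ctx r) [] ∘ π
cnt (push π r) = cnt r

push-cong : ∀ {X Y} (π : Y → Maybe X) {r s} → r ≈ s → push π r ≈ push π s
push-cong π {r} {s} eq = go , cnt-≈ eq
  where
  go : ctx (push π r) ≅ ctx (push π s)
  go y with π y
  ... | just x  = ctx-≈ eq x
  ... | nothing = ≋-refl

push-∙ : ∀ {X Y} (π : Y → Maybe X) r s → push π (r ∙ s) ≈ push π r ∙ push π s
push-∙ π r s = go , λ _ → ≡-refl
  where
  go : ctx (push π (r ∙ s)) ≅ ctx (push π r ∙ push π s)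
  go y with π y
  ... | just x  = ≋-refl
  ... | nothing = ≋-refl

push-cost : ∀ {X Y} (π : Y → Maybe X) c → push π (cost c) ≈ cost c
push-cost π c = go , λ _ → ≡-refl
  where
  go : ctx (push π (cost c)) ≅ ∅
  go y with π y
  ... | just x  = ≋-refl
  ... | nothing = ≋-refl

push->>= : ∀ {X Y Z} (π : Y → Maybe X) (π′ : Z → Maybe Y) r →
           push (λ z → π′ z >>= π) r ≈ push π′ (push π r)
push->>= π π′ r = go , λ _ → ≡-refl
  where
  go : ctx (push (λ z → π′ z >>= π) r) ≅ ctx (push π′ (push π r))
  go z with π′ z
  ... | just y  = ≋-refl
  ... | nothing = ≋-refl

-- For injective ρ with partial inverse π, stated as what the rule ax needs.
record _InverseOf_ (π : Fin n → Maybe (Fin m)) (ρ : Fin m → Fin n) : Set where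
  no-eta-equality
  field
    push-singleton : ∀ x σ y → maybe′ (x ∶[ σ ]) [] (π y) ≡ (ρ x ∶[ σ ]) y

open _InverseOf_

inverse-∘ : ∀ {k} {ρ : Fin m → Fin n} {π} {ρ′ : Fin n → Fin k} {π′} →
            π InverseOf ρ → π′ InverseOf ρ′ → (λ z → π′ z >>= π) InverseOf (ρ′ ∘ ρ)
push-singleton (inverse-∘ {ρ = ρ} {π} {ρ′} {π′} inv inv′) x σ z =
  ≡-trans go (push-singleton inv′ (ρ x) σ z)
  where
  go : maybe′ (x ∶[ σ ]) [] (π′ z >>= π) ≡ maybe′ (ρ x ∶[ σ ]) [] (π′ z)
  go with π′ z
  ... | just y  = push-singleton inv x σ y
  ... | nothing = ≡-refl

wkInverse : ∀ p → Fin (n ▹ p) → Maybe (Fin n)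
wkInverse pvar       zero    = nothing
wkInverse pvar       (suc y) = just y
wkInverse ⟨ p , q ⟩ᵖ y       = wkInverse p y >>= wkInverse q

wkInverse-inverse : ∀ p → wkInverse p InverseOf wkVar {n} p
push-singleton (wkInverse-inverse pvar) x σ zero    = ≡-refl
push-singleton (wkInverse-inverse pvar) x σ (suc y) = ≡-refl
wkInverse-inverse ⟨ p , q ⟩ᵖ = inverse-∘ (wkInverse-inverse q) (wkInverse-inverse p)

wkInverse-wkVar : ∀ p (x : Fin n) → wkInverse p (wkVar p x) ≡ just x
wkInverse-wkVar pvar       x = ≡-refl
wkInverse-wkVar ⟨ p , q ⟩ᵖ x rewrite wkInverse-wkVar p (wkVar q x) = wkInverse-wkVar q x

wkInverse-boundVar : ∀ p v → wkInverse {n} p (boundVar p v) ≡ nothing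
wkInverse-boundVar pvar       tt       = ≡-refl
wkInverse-boundVar {n} ⟨ p , q ⟩ᵖ (inj₁ v) rewrite wkInverse-boundVar {n ▹ q} p v = ≡-refl
wkInverse-boundVar {n} ⟨ p , q ⟩ᵖ (inj₂ v) rewrite wkInverse-wkVar p (boundVar {n} q v) = wkInverse-boundVar q v

liftInverse : ∀ p → (Fin n → Maybe (Fin m)) → Fin (n ▹ p) → Maybe (Fin (m ▹ p))
liftInverse pvar       π zero    = just zero
liftInverse pvar       π (suc y) = map suc (π y)
liftInverse ⟨ p , q ⟩ᵖ π         = liftInverse p (liftInverse q π)

liftInverse-inverse : ∀ p {ρ : Fin m → Fin n} {π} → π InverseOf ρ → liftInverse p π InverseOf liftRen p ρ
push-singleton (liftInverse-inverse pvar inv) zero    σ zero    = ≡-refl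
push-singleton (liftInverse-inverse pvar {π = π} inv) zero    σ (suc y) with π y
... | just x  = ≡-refl
... | nothing = ≡-refl
push-singleton (liftInverse-inverse pvar inv) (suc x) σ zero    = ≡-refl
push-singleton (liftInverse-inverse pvar {π = π} inv) (suc x) σ (suc y) with π y | push-singleton inv x σ y
... | just _  | eq = eq
... | nothing | eq = eq
liftInverse-inverse ⟨ p , q ⟩ᵖ inv = liftInverse-inverse p (liftInverse-inverse q inv)

liftInverse-wkVar : ∀ p (π : Fin n → Maybe (Fin m)) y → liftInverse p π (wkVar p y) ≡ map (wkVar p) (π y)
liftInverse-wkVar pvar       π y = ≡-refl
liftInverse-wkVar ⟨ p , q ⟩ᵖ π y = ≡-trans (liftInverse-wkVar p (liftInverse q π) (wkVar q y))
  (≡-trans (cong (map (wkVar p)) (liftInverse-wkVar q π y)) (≡-sym (map-∘ (π y))))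

liftInverse-boundVar : ∀ p (π : Fin n → Maybe (Fin m)) v → liftInverse p π (boundVar p v) ≡ just (boundVar p v)
liftInverse-boundVar pvar       π tt       = ≡-refl
liftInverse-boundVar ⟨ p , q ⟩ᵖ π (inj₁ v) = liftInverse-boundVar p (liftInverse q π) v
liftInverse-boundVar ⟨ p , q ⟩ᵖ π (inj₂ v) = ≡-trans (liftInverse-wkVar p (liftInverse q π) (boundVar q v))
  (cong (map (wkVar p)) (liftInverse-boundVar q π v))

push-drop : ∀ p (π : Fin n → Maybe (Fin m)) r → drop p (push (liftInverse p π) r) ≈ push π (drop p r)
push-drop p π r = go , λ _ → ≡-refl
  where
  go : ∀ y → maybe′ (ctx r) [] (liftInverse p π (wkVar p y)) ≋ maybe′ (ctx r ∘ wkVar p) [] (π y)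
  go y rewrite liftInverse-wkVar p π y with π y
  ... | just x  = ≋-refl
  ... | nothing = ≋-refl

push-restrict : ∀ p (π : Fin n → Maybe (Fin m)) r → restrict p (ctx r) ≅ restrict p (ctx (push (liftInverse p π) r))
push-restrict p π r v rewrite liftInverse-boundVar p π v = ≋-refl

-- With `weaken-restrict`, this is the typing content of the freshness conditions of (b) and (m): a
-- weakened term contributes nothing to the variables of `p`.
weaken-drop : ∀ p (r : Resource (Fin n)) → drop p (push (wkInverse p) r) ≈ r
weaken-drop p r = (λ x → ≡⇒≋ (cong (maybe′ (ctx r) []) (wkInverse-wkVar p x))) , λ _ → ≡-refl

weaken-restrict : ∀ p (r : Resource (Fin n)) → restrict p (ctx (push (wkInverse p) r)) ≅ ∅
weaken-restrict p r v = ≡⇒≋ (cong (maybe′ (ctx r) []) (wkInverse-boundVar p v))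

push-binder : ∀ p {π : Fin n → Maybe (Fin m)} {c r} s → r ≈ cost c ∙ drop p s →
              push π r ≈ cost c ∙ drop p (push (liftInverse p π) s)
push-binder p {π} s eq = ≈-trans (push-cong π eq)
  (≈-trans (push-∙ π _ (drop p s)) (∙-cong (push-cost π _) (≈-sym (push-drop p π s))))

mutual
  rename-typing : ∀ {ρ : Fin m → Fin n} {π} → π InverseOf ρ → r ⊢ t ∶ σ → push π r ⊢ rename ρ t ∶ σ
  rename-typing {π = π} inv (ax {x} {σ} eq) =
    ax (≈-trans (push-cong π eq) ((≡⇒≋ ∘ push-singleton inv x σ) , λ _ → ≡-refl))
  rename-typing {π = π} inv (abs {p} {s} d κ eq ty) =
    abs (rename-typing (liftInverse-inverse p inv) d)
        (pattern-conv (push-restrict p π s) ≋-refl κ)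
        (push-binder p s eq) ty
  rename-typing {π = π} inv (abs-p {p} {s} d tgt eq) =
    abs-p (rename-typing (liftInverse-inverse p inv) d)
          (tightCtx-resp (push-restrict p π s) tgt)
          (push-binder p s eq)
  rename-typing {π = π} inv (app {s} {s′} d d′ eq) =
    app (rename-typing inv d) (rename-typing* inv d′) (≈-trans (push-cong π eq) (push-∙ π s s′))
  rename-typing {π = π} inv (app-p {s} d eq) =
    app-p (rename-typing inv d)
      (≈-trans (push-cong π eq) (≈-trans (push-∙ π _ s) (∙-congʳ (push-cost π _))))
  rename-typing {π = π} inv (pair {s} {s′} d d′ eq ty) =
    pair (rename-typing* inv d) (rename-typing* inv d′) (≈-trans (push-cong π eq) (push-∙ π s s′)) ty
  rename-typing {π = π} inv (pair-p eq) = pair-p (≈-trans (push-cong π eq) (push-cost π _))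
  rename-typing {π = π} inv (match {p} {s} {s′} d κ d′ eq) =
    match (rename-typing (liftInverse-inverse p inv) d)
          (pattern-conv (push-restrict p π s) ≋-refl κ)
          (rename-typing* inv d′)
          (≈-trans (push-cong π eq)
            (≈-trans (push-∙ π _ _)
              (∙-cong (push-cost π _)
                (≈-trans (push-∙ π (drop p s) s′) (∙-congʳ (≈-sym (push-drop p π s)))))))

  rename-typing* : ∀ {ρ : Fin m → Fin n} {π} → π InverseOf ρ → r ⊢* t ∶ A → push π r ⊢* rename ρ t ∶ A
  rename-typing* {π = π} inv (nil eq) = nil (≈-trans (push-cong π eq) (push-cost π _))
  rename-typing* {π = π} inv (cons {s} {s′} d ds eq) =
    cons (rename-typing inv d) (rename-typing* inv ds) (≈-trans (push-cong π eq) (push-∙ π s s′))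

-- Substitution

-- r is the total resource of derivations of θ x ∶ Γ x, one for each variable x.
data Env {n} : ∀ {m} → (Fin m → Term n) → Ctx (Fin m) → Resource (Fin n) → Set where
  nil  : ∀ {θ Γ r} → r ≈ ε → Env {m = 0} θ Γ r
  cons : ∀ {m θ Γ r s s′} → s ⊢* θ zero ∶ Γ zero → Env (θ ∘ suc) (Γ ∘ suc) s′ → r ≈ s ∙ s′ →
         Env {m = suc m} θ Γ r

split* : ∀ A → r ⊢* t ∶ A ++ B → ∃[ s ] ∃[ s′ ] (s ⊢* t ∶ A) × (s′ ⊢* t ∶ B) × r ≈ s ∙ s′
split* []      ds = ε , _ , nil ≈-refl , ds , ≈-sym (identityˡ _)
split* (σ ∷ A) (cons d ds eq) with split* A ds
... | s , s′ , ds₁ , ds₂ , eq′ =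
  _ , s′ , cons d ds₁ ≈-refl , ds₂ , ≈-trans eq (≈-trans (∙-congˡ eq′) (≈-sym (assoc _ _ _)))

-- When a typing rule divides its context between two premises, each derivation for a substituted
-- term goes to exactly one of them; this keeps the counters exact under substitution.
env-split : ∀ {θ : Fin m → Term n} Γ {Δ} → Env θ (Γ ∧ Δ) r →
            ∃[ s ] ∃[ s′ ] Env θ Γ s × Env θ Δ s′ × r ≈ s ∙ s′
env-split Γ (nil eq) = ε , ε , nil ≈-refl , nil ≈-refl , ≈-trans eq (≈-sym (identityˡ ε))
env-split Γ (cons ds η eq) with split* (Γ zero) ds | env-split (Γ ∘ suc) η
... | _ , _ , ds₁ , ds₂ , eq₁ | _ , _ , η₁ , η₂ , eq₂ =
  _ , _ , cons ds₁ η₁ ≈-refl , cons ds₂ η₂ ≈-refl ,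
  ≈-trans eq (≈-trans (∙-cong eq₁ eq₂) (interchange _ _ _ _))

env-∅ : ∀ {θ : Fin m → Term n} → Env θ ∅ r → r ≈ ε
env-∅ (nil eq) = eq
env-∅ (cons (nil eq′) η eq) = ≈-trans eq (≈-trans (∙-cong eq′ (env-∅ η)) (identityˡ ε))

env-singleton : ∀ {θ : Fin m → Term n} x → Env θ (x ∶[ σ ]) r → r ⊢ θ x ∶ σ
env-singleton zero    (cons (cons d (nil eq″) eq′) η eq) =
  ≈-conv (≈-trans eq (≈-trans (∙-cong (≈-trans eq′ (≈-trans (∙-congˡ eq″) (identityʳ _))) (env-∅ η)) (identityʳ _))) d
env-singleton (suc x) (cons (nil eq′) η eq) =
  ≈-conv (≈-trans eq (≈-trans (∙-congʳ eq′) (identityˡ _))) (env-singleton x η)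

env-conv : ∀ {θ : Fin m → Term n} {Γ Δ} → Γ ≅ Δ → Env θ Γ r → Env θ Δ r
env-conv eq (nil eq′)       = nil eq′
env-conv eq (cons ds η eq′) = cons (≋-conv* (eq zero) ds) (env-conv (eq ∘ suc) η) eq′

env-weaken : ∀ {θ : Fin m → Term n} {Γ} → Env θ Γ r → Env (rename suc ∘ θ) Γ (push (wkInverse pvar) r)
env-weaken (nil eq)       = nil (≈-trans (push-cong (wkInverse pvar) eq) (push-cost _ _))
env-weaken (cons ds η eq) =
  cons (rename-typing* (wkInverse-inverse pvar) ds) (env-weaken η)
       (≈-trans (push-cong (wkInverse pvar) eq) (push-∙ _ _ _))

bound : MTy → Resource (Fin (suc n))
ctx (bound A) zero    = A
ctx (bound A) (suc _) = []
cnt (bound A)         = const 0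

-- Axioms cost nothing, so a variable that is mapped to itself, under a binder or by an identity
-- substitution, leaves the counters alone.
bound-typing : ∀ A → bound {n} A ⊢* ` zero ∶ A
bound-typing []      = nil ((λ { zero → ≋-refl ; (suc _) → ≋-refl }) , λ _ → ≡-refl)
bound-typing (σ ∷ A) =
  cons (ax {r = bound [ σ ]} ((λ { zero → ≋-refl ; (suc _) → ≋-refl }) , λ _ → ≡-refl))
       (bound-typing A) ((λ { zero → ≋-refl ; (suc _) → ≋-refl }) , λ _ → ≡-refl)

-- The variables of `p` are mapped to themselves and so keep their multi-types; the last component
-- lets the pattern typing of the binder be reused.
env-lift : ∀ p {θ : Fin m → Term n} {Γ} → Env θ (Γ ∖ p) r →
           ∃[ s ] Env (liftSub p θ) Γ s × drop p s ≈ r × (restrict p Γ ≅ restrict p (ctx s))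
env-lift pvar {Γ = Γ} η =
  bound (Γ zero) ∙ push (wkInverse pvar) _ , cons (bound-typing (Γ zero)) (env-weaken η) ≈-refl ,
  ((λ _ → ≋-refl) , λ _ → ≡-refl) , λ _ → ≋-sym (Perm.++-identityʳ _)
env-lift ⟨ p , q ⟩ᵖ η with env-lift q η
... | s , η′ , eq , eq′ with env-lift p η′
... | s″ , η″ , eq₁ , eq₁′ =
  s″ , η″ , ((λ x → trans (ctx-≈ eq₁ (wkVar q x)) (ctx-≈ eq x)) , λ i → ≡-trans (cnt-≈ eq₁ i) (cnt-≈ eq i)) ,
  λ where
    (inj₁ v) → eq₁′ v
    (inj₂ v) → trans (eq′ v) (≋-sym (ctx-≈ eq₁ (boundVar q v)))

env-id : ∀ (r : Resource (Fin n)) → cnt r ≡ const 0 → Env `_ (ctx r) r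
env-id {zero}  r eq = nil ((λ ()) , λ i → cong (λ c → c i) eq)
env-id {suc n} r eq = cons (bound-typing (ctx r zero)) (env-weaken (env-id (ctx r ∘ suc , cnt r) eq))
  ((λ { zero → ≋-sym (Perm.++-identityʳ _) ; (suc _) → ≋-refl }) , λ _ → ≡-refl)

cost-∙ : ∀ {X Y} {r r₁ r₂ : Resource X} → r ≈ r₁ ∙ r₂ → cost {Y} (cnt r) ≈ cost (cnt r₁) ∙ cost (cnt r₂)
cost-∙ eq = (λ _ → ≋-refl) , cnt-≈ eq

subst-∙ : ∀ {X Y} {r r₁ r₂ : Resource X} {s s₁ s₂ : Resource Y} → r ≈ r₁ ∙ r₂ → s ≈ s₁ ∙ s₂ →
          cost (cnt r) ∙ s ≈ (cost (cnt r₁) ∙ s₁) ∙ (cost (cnt r₂) ∙ s₂)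
subst-∙ eq eq′ = ≈-trans (∙-cong (cost-∙ eq) eq′) (interchange _ _ _ _)

subst-binder : ∀ p {r : Resource (Fin n)} {c r₁ s} {s₁ : Resource (Fin (m ▹ p))} →
               r ≈ cost c ∙ drop p r₁ → drop p s₁ ≈ s →
               cost (cnt r) ∙ s ≈ cost c ∙ drop p (cost (cnt r₁) ∙ s₁)
subst-binder p eq eq′ = ≈-trans (∙-congʳ (cost-∙ eq)) (≈-trans (assoc _ _ _)
  (∙-congˡ (≈-trans (∙-congˡ (≈-sym eq′)) ((λ _ → ≋-refl) , λ _ → ≡-refl))))

mutual
  -- The substitution is simultaneous and replaces every variable: only the counters of `r` survive,
  -- while the context comes entirely from the environment.
  subst-typing : ∀ {θ : Fin m → Term n} → r ⊢ t ∶ σ → Env θ (ctx r) s → cost (cnt r) ∙ s ⊢ subst θ t ∶ σ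
  subst-typing (ax {x} eq) η =
    ≈-conv (≈-trans (∙-congʳ ((λ _ → ≋-refl) , cnt-≈ eq)) (identityˡ _))
           (env-singleton x (env-conv (ctx-≈ eq) η))
  subst-typing (abs {p} d κ eq ty) η with env-lift p (env-conv (ctx-≈ eq) η)
  ... | _ , η′ , eq₁ , eq₂ =
    abs (subst-typing d η′) (pattern-conv eq₂ ≋-refl κ) (subst-binder p eq eq₁) ty
  subst-typing (abs-p {p} d tgt eq) η with env-lift p (env-conv (ctx-≈ eq) η)
  ... | _ , η′ , eq₁ , eq₂ =
    abs-p (subst-typing d η′) (tightCtx-resp eq₂ tgt) (subst-binder p eq eq₁)
  subst-typing (app {s₁} d d′ eq) η with env-split (ctx s₁) (env-conv (ctx-≈ eq) η)
  ... | _ , _ , η₁ , η₂ , eq′ = app (subst-typing d η₁) (subst-typing* d′ η₂) (subst-∙ eq eq′)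
  subst-typing (app-p d eq) η =
    app-p (subst-typing d (env-conv (ctx-≈ eq) η))
      (≈-trans (∙-congʳ (cost-∙ eq)) (assoc _ _ _))
  subst-typing (pair {s₁} d d′ eq ty) η with env-split (ctx s₁) (env-conv (ctx-≈ eq) η)
  ... | _ , _ , η₁ , η₂ , eq′ = pair (subst-typing* d η₁) (subst-typing* d′ η₂) (subst-∙ eq eq′) ty
  subst-typing (pair-p eq) η =
    pair-p (≈-trans (∙-cong ((λ _ → ≋-refl) , cnt-≈ eq) (env-∅ (env-conv (ctx-≈ eq) η))) (identityʳ _))
  subst-typing (match {p} {s₁} {s₂} d κ d′ eq) η with env-split (ctx s₁ ∖ p) (env-conv (ctx-≈ eq) η)
  ... | _ , _ , η₁ , η₂ , eq′ with env-lift p η₁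
  ... | _ , η₁′ , eq₁ , eq₂ =
    match (subst-typing d η₁′) (pattern-conv eq₂ ≋-refl κ) (subst-typing* d′ η₂)
      (≈-trans (∙-congʳ (cost-∙ eq)) (≈-trans (assoc _ _ _) (∙-congˡ
        (≈-trans (subst-∙ {r₁ = drop p s₁} {r₂ = s₂} ≈-refl eq′)
                 (∙-congʳ (≈-trans (∙-congˡ (≈-sym eq₁)) ((λ _ → ≋-refl) , λ _ → ≡-refl)))))))

  subst-typing* : ∀ {θ : Fin m → Term n} → r ⊢* t ∶ A → Env θ (ctx r) s → cost (cnt r) ∙ s ⊢* subst θ t ∶ A
  subst-typing* (nil eq) η =
    nil (≈-trans (∙-cong ((λ _ → ≋-refl) , cnt-≈ eq) (env-∅ (env-conv (ctx-≈ eq) η))) (identityʳ _))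
  subst-typing* (cons {s₁} d ds eq) η with env-split (ctx s₁) (env-conv (ctx-≈ eq) η)
  ... | _ , _ , η₁ , η₂ , eq′ = cons (subst-typing d η₁) (subst-typing* ds η₂) (subst-∙ eq eq′)

-- Subject reduction

throughInverse : ∀ {n′} → LCtx n n′ → Fin n′ → Maybe (Fin n)
throughInverse □           = just
throughInverse (les p L u) = λ y → throughInverse L y >>= wkInverse p

throughInverse-inverse : ∀ {n′} (L : LCtx n n′) → throughInverse L InverseOf throughVar L
push-singleton (throughInverse-inverse □) x σ y = ≡-refl
throughInverse-inverse (les p L u) = inverse-∘ (wkInverse-inverse p) (throughInverse-inverse L)

module _ {X : Set} where
  open Solver (resources X) using (solve; _⊜_) renaming (_⊕_ to _⊞_)

  a[bc]∙d≈a∙[bd]c : ∀ a b c d → (a ∙ (b ∙ c)) ∙ d ≈ a ∙ ((b ∙ d) ∙ c)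
  a[bc]∙d≈a∙[bd]c = solve 4 (λ a b c d → (a ⊞ (b ⊞ c)) ⊞ d ⊜ a ⊞ ((b ⊞ d) ⊞ c)) ≈-refl

  ab∙cd≈a∙d[bc] : ∀ a b c d → (a ∙ b) ∙ (c ∙ d) ≈ a ∙ (d ∙ (b ∙ c))
  ab∙cd≈a∙d[bc] = solve 4 (λ a b c d → (a ⊞ b) ⊞ (c ⊞ d) ⊜ a ⊞ (d ⊞ (b ⊞ c))) ≈-refl

  ab∙cde≈d∙[c∙ea]b : ∀ a b c d e → (a ∙ b) ∙ ((c ∙ d) ∙ e) ≈ d ∙ ((c ∙ (e ∙ a)) ∙ b)
  ab∙cde≈d∙[c∙ea]b =
    solve 5 (λ a b c d e → (a ⊞ b) ⊞ ((c ⊞ d) ⊞ e) ⊜ d ⊞ ((c ⊞ (e ⊞ a)) ⊞ b)) ≈-refl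

-- Replacing the hole of L may lower the counters by c and consume the extra resource d.
replace-hole : ∀ {n′} (L : LCtx n n′) {t} → r ⊢ L ⟪⟪ t ⟫⟫ ∶ σ →
  ∃[ s ] (s ⊢ t ∶ σ) ×
    (∀ {c s′ d u τ} → s ≈ cost c ∙ s′ → s′ ∙ push (throughInverse L) d ⊢ u ∶ τ →
     ∃[ r′ ] r ≈ cost c ∙ r′ × (r′ ∙ d ⊢ L ⟪⟪ u ⟫⟫ ∶ τ))
replace-hole □ d = _ , d , λ eq d′ → _ , eq , ≈-conv (∙-congˡ ((λ _ → ≋-refl) , λ _ → ≡-refl)) d′
replace-hole (les p L v) (match {s = s₁} {s₂} {c = cₚ} d κ d′ eq) with replace-hole L d
... | s , hole , fill = s , hole , λ {c} {d = q} eq₁ d₁ →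
  let s₁′ , eq₂ , d₂ = fill eq₁ (≈-conv (∙-congˡ (≈-sym (push->>= (wkInverse p) (throughInverse L) q))) d₁)
  in  cost cₚ ∙ (drop p s₁′ ∙ s₂)
    , ≈-trans eq (≈-trans (∙-congˡ (≈-trans (∙-congʳ
        (≈-trans (drop-cong p eq₂) ((λ _ → ≋-refl) , λ _ → ≡-refl))) (assoc (cost c) _ _))) (x∙yz≈y∙xz _ _ _))
    , match d₂
        (pattern-conv (λ v → trans (ctx-≈ eq₂ (boundVar p v))
          (trans (≋-sym (Perm.++-identityʳ _)) (Perm.++⁺ˡ _ (≋-sym (weaken-restrict p q v))))) ≋-refl κ)
        d′
        (≈-trans (a[bc]∙d≈a∙[bd]c (cost cₚ) (drop p s₁′) s₂ q) (∙-congˡ (∙-congʳ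
          (≈-trans (∙-congˡ (≈-sym (weaken-drop p q))) ((λ _ → ≋-refl) , λ _ → ≡-refl)))))

singleton* : r ⊢* t ∶ [ σ ] → r ⊢ t ∶ σ
singleton* (cons d (nil eq′) eq) = ≈-conv (≈-trans eq (≈-trans (∙-congˡ eq′) (identityʳ _))) d

to-singleton* : r ⊢ t ∶ σ → r ⊢* t ∶ [ σ ]
to-singleton* d = cons d (nil ≈-refl) (≈-sym (identityʳ _))

-- The one-element multi-type gives the matched term exactly one derivation: a step by `ξ-r` is
-- counted once, and progress has a derivation to recurse on.
pair-pattern-type : ∀ {p q Γ c} → Γ ⊩[ c ] ⟨ p , q ⟩ᵖ ∶ A → ∃[ σ ] [ σ ] ≋ A
pair-pattern-type (pat-× _ _ eq) = _ , eq
pair-pattern-type (pat-p _ eq)   = _ , eq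

cost-⊕ : ∀ {X} c d → cost {X} (c ⊕ d) ≈ cost c ∙ cost d
cost-⊕ c d = (λ _ → ≋-refl) , λ _ → ≡-refl

drop-cost-∙ : ∀ p c {s s′ : Resource (Fin (n ▹ p))} → s ≈ cost c ∙ s′ → drop p s ≈ cost c ∙ drop p s′
drop-cost-∙ p c eq = ≈-trans (drop-cong p eq) ((λ _ → ≋-refl) , λ _ → ≡-refl)

e-reduction : r ⊢ t [ pvar / u ] ∶ σ → ∃[ r′ ] r ≈ cost (tick (step ke)) ∙ r′ × (r′ ⊢ t ⟪ u ⟫ ∶ σ)
e-reduction (match {s = s} d (pat-v e) d′ eq) = _ ,
  ≈-trans eq (∙-congˡ (≈-trans (∙-congʳ eq₁) (≈-trans (assoc _ _ _) (∙-congˡ (comm _ _))))) ,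
  -- The environment consists of the derivations of `u` for the substituted variable and of axioms
  -- for all others.
  subst-typing d (cons (≋-conv* (≋-sym e) d′) (env-id (ctx s ∘ suc , const 0) ≡-refl) ≈-refl)
  where
  eq₁ : drop pvar s ≈ cost (cnt s) ∙ (ctx s ∘ suc , const 0)
  eq₁ = (λ _ → ≋-refl) , λ _ → ≡-sym (+-identityʳ _)

-- A list context hands on the type of its hole, so the new filling may replace the arrow type by
-- its target. The argument is the extra resource that moves under `L`.
b-reduction : ∀ {n′} (L : LCtx n n′) {p t} → r ⊢ L ⟪⟪ ƛ p t ⟫⟫ · u ∶ σ →
  ∃[ r′ ] r ≈ cost (tick (step kb)) ∙ r′ × (r′ ⊢ L ⟪⟪ t [ p / rename (throughVar L) u ] ⟫⟫ ∶ σ)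
b-reduction L (app d d′ eq) with replace-hole L d
... | _ , abs {p} {s} {c = c} dₜ κ eq₁ (a ⇒ ty) , fill =
  let r′ , eq₂ , d₂ = fill (≈-trans eq₁ (≈-trans (∙-congʳ (≈-trans (cost-⊕ c _) (comm _ _))) (assoc _ _ _)))
                           (match (≃-conv ty dₜ) κ
                             (≋-conv* (≋-sym a) (rename-typing* (throughInverse-inverse L) d′))
                             (assoc (cost c) _ _))
  in  _ , ≈-trans eq (≈-trans (∙-congʳ eq₂) (assoc _ _ _)) , d₂
b-reduction L (app-p d eq) with replace-hole L d
... | _ , abs _ _ _ () , _

m-reduction : ∀ {n′} (L : LCtx n n′) {p₁ p₂ t u₁ u₂} → r ⊢ t [ ⟨ p₁ , p₂ ⟩ᵖ / L ⟪⟪ ⟨ u₁ , u₂ ⟩ ⟫⟫ ] ∶ σ →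
  ∃[ r′ ] r ≈ cost (tick (step km)) ∙ r′ ×
    (r′ ⊢ L ⟪⟪ rename (liftRen ⟨ p₁ , p₂ ⟩ᵖ (throughVar L)) t
                 [ p₁ / rename (wkVar p₂) u₁ ] [ p₂ / u₂ ] ⟫⟫ ∶ σ)
-- A persistent pattern demands the type `tight •𝓝`, which no pair has.
m-reduction L (match d (pat-p _ e) d′ eq) with replace-hole L (singleton* (≋-conv* (≋-sym e) d′))
... | _ , pair _ _ _ () , _
m-reduction L {p₁} {p₂} (match {s = s} d (pat-× {c = c₁} {c₂} κ₁ κ₂ e) d′ eq)
  with replace-hole L (singleton* (≋-conv* (≋-sym e) d′))
... | h , pair {h₁} {h₂} d₁ d₂ eq₁ (a ⊗ b) , fill =
  -- The hole itself pays nothing, whence `const 0`: the unit of (m) comes from `pat-×`. What moves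
  -- under `L` is the body `t` together with the charges of `p₁` and `p₂`.
  let r′ , eq₂ , d₃ = fill {c = const 0} {s′ = h} {d = cost (c₁ ⊕ c₂) ∙ drop p₂ (drop p₁ s)}
                        (≈-sym (identityˡ _)) typing
  in  _ , ≈-trans eq (≈-trans (∙-cong (cost-⊕ _ _) (∙-cong ((λ _ → ≋-refl) , λ _ → ≡-refl) (≈-trans eq₂ (identityˡ _))))
            (ab∙cd≈a∙d[bc] _ _ _ _)) , d₃
  where
  π   = throughInverse L
  inv = throughInverse-inverse L

  typing = match
    (match (rename-typing (liftInverse-inverse ⟨ p₁ , p₂ ⟩ᵖ inv) d)
           (pattern-conv (push-restrict p₁ (liftInverse p₂ π) s) (≋-sym a) κ₁)
           (rename-typing* (wkInverse-inverse p₂) d₁) ≈-refl)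
    -- Since `u₁` is weakened by `p₂`, the types of the variables of `p₂` all come from `t`.
    (pattern-conv (λ v →
        trans (push-restrict p₂ π (drop p₁ s) v)
        (trans (≋-sym (ctx-≈ (push-drop p₁ (liftInverse p₂ π) s) (boundVar p₂ v)))
        (trans (≋-sym (Perm.++-identityʳ _)) (Perm.++⁺ˡ _ (≋-sym (weaken-restrict p₂ h₁ v))))))
      (≋-sym b) κ₂)
    d₂
    (≈-trans (∙-cong eq₁ (≈-trans (push-∙ π _ _) (∙-congʳ (≈-trans (push-cost π _) (cost-⊕ c₁ c₂)))))
    (≈-trans (ab∙cde≈d∙[c∙ea]b h₁ h₂ (cost c₁) (cost c₂) _)
      (∙-congˡ (∙-congʳ (≈-trans (∙-congˡ (∙-cong
          (≈-trans (≈-sym (push-drop p₂ π (drop p₁ s))) (drop-cong p₂ (≈-sym (push-drop p₁ (liftInverse p₂ π) s))))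
          (≈-sym (weaken-drop p₂ h₁))))
        ((λ _ → ≋-refl) , λ _ → ≡-refl))))))

match-left : ∀ p {c cₚ} {s s₁ : Resource (Fin (n ▹ p))} {t} → s₁ ⊢ t ∶ σ → restrict p (ctx s) ⊩[ cₚ ] p ∶ A → s′ ⊢* u ∶ A →
             r ≈ cost cₚ ∙ (drop p s ∙ s′) → s ≈ cost c ∙ s₁ →
             ∃[ r′ ] r ≈ cost c ∙ r′ × (r′ ⊢ t [ p / u ] ∶ σ)
match-left p d κ d′ eq eq′ = _ ,
  ≈-trans eq (≈-trans (∙-congˡ (≈-trans (∙-congʳ (drop-cost-∙ p _ eq′)) (assoc _ _ _))) (x∙yz≈y∙xz _ _ _)) ,
  match d (pattern-conv (ctx-≈ eq′ ∘ boundVar p) ≋-refl κ) d′ ≈-refl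

subject-reduction : ∀ {k t′} → r ⊢ t ∶ σ → t ⟶⟨ k ⟩ t′ → ∃[ r′ ] r ≈ cost (tick (step k)) ∙ r′ × (r′ ⊢ t′ ∶ σ)
subject-reduction (abs {p} d κ eq ty) (ξ-lam ρ) with subject-reduction d ρ
... | _ , eq′ , d′ = _ , ≈-trans eq (≈-trans (∙-congˡ (drop-cost-∙ p _ eq′)) (x∙yz≈y∙xz _ _ _)) ,
  abs d′ (pattern-conv (ctx-≈ eq′ ∘ boundVar p) ≋-refl κ) ≈-refl ty
subject-reduction (abs-p {p} d tgt eq) (ξ-lam ρ) with subject-reduction d ρ
... | _ , eq′ , d′ = _ , ≈-trans eq (≈-trans (∙-congˡ (drop-cost-∙ p _ eq′)) (x∙yz≈y∙xz _ _ _)) ,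
  abs-p d′ (tightCtx-resp (ctx-≈ eq′ ∘ boundVar p) tgt) ≈-refl
subject-reduction d@(app _ _ _) (β-b L p s ≡-refl) = b-reduction L d
subject-reduction d@(app-p _ _) (β-b L p s ≡-refl) = b-reduction L d
subject-reduction (app d₁ d₂ eq) (ξ-app ρ _) with subject-reduction d₁ ρ
... | _ , eq′ , d′ = _ , ≈-trans eq (≈-trans (∙-congʳ eq′) (assoc _ _ _)) , app d′ d₂ ≈-refl
subject-reduction (app-p d eq) (ξ-app ρ _) with subject-reduction d ρ
... | _ , eq′ , d′ = _ , ≈-trans eq (≈-trans (∙-congˡ eq′) (x∙yz≈y∙xz _ _ _)) , app-p d′ ≈-refl
subject-reduction d@(match {pvar} _ _ _ _) (β-e _) = e-reduction d
subject-reduction (match {pvar} d κ d₂ eq) (ξ-l ρ) with subject-reduction d ρ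
... | _ , eq′ , d′ = match-left pvar d′ κ d₂ eq eq′
subject-reduction d@(match {⟨ _ , _ ⟩ᵖ} _ _ _ _) (β-m L u₁ u₂ ≡-refl _) = m-reduction L d
subject-reduction (match {⟨ p₁ , p₂ ⟩ᵖ} d κ d₂ eq) (ξ-l ρ) with subject-reduction d ρ
... | _ , eq′ , d′ = match-left ⟨ p₁ , p₂ ⟩ᵖ d′ κ d₂ eq eq′
subject-reduction (match {⟨ p₁ , p₂ ⟩ᵖ} d κ d₂ eq) (ξ-r _ ρ) with pair-pattern-type κ
... | _ , e with subject-reduction (singleton* (≋-conv* (≋-sym e) d₂)) ρ
... | _ , eq′ , d′ = _ ,
  ≈-trans eq (≈-trans (∙-congˡ (≈-trans (∙-congˡ eq′) (x∙yz≈y∙xz _ _ _))) (x∙yz≈y∙xz _ _ _)) ,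
  match d κ (≋-conv* e (to-singleton* d′)) ≈-refl

private
  module ℕ-Properties = CommutativeSemigroupProperties +-commutativeSemigroup

-- Progress and canonical forms

-- Whether `t` is an abstraction under a list context decides between (b) and `ξ-app`, so progress
-- has to test it.
abs? : (t : Term n) → Dec (Abs t)
abs? (` x)         = no λ { (_ , _ , _ , □ , ()) ; (_ , _ , _ , les _ _ _ , ()) }
abs? (ƛ p t)       = yes (_ , p , t , □ , ≡-refl)
abs? ⟨ t , u ⟩     = no λ { (_ , _ , _ , □ , ()) ; (_ , _ , _ , les _ _ _ , ()) }
abs? (t · u)       = no λ { (_ , _ , _ , □ , ()) ; (_ , _ , _ , les _ _ _ , ()) }
abs? (t [ p / u ]) with abs? t
... | yes (_ , q , s , L , ≡-refl) = yes (_ , q , s , les p L u , ≡-refl)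
... | no ¬abs = no λ { (_ , _ , _ , □ , ()) ; (_ , q , s , les _ L _ , ≡-refl) → ¬abs (_ , q , s , L , ≡-refl) }

PairLike : Term n → Set
PairLike {n} t = ∃[ n′ ] ∃[ u₁ ] ∃[ u₂ ] Σ[ L ∈ LCtx n n′ ] t ≡ L ⟪⟪ ⟨ u₁ , u₂ ⟩ ⟫⟫

neutral-¬abs : 𝓝 t → ¬ Abs t
neutral-¬abs var         (_ , _ , _ , □ , ())
neutral-¬abs var         (_ , _ , _ , les _ _ _ , ())
neutral-¬abs (app ν)     (_ , _ , _ , □ , ())
neutral-¬abs (app ν)     (_ , _ , _ , les _ _ _ , ())
neutral-¬abs (match ν _) (_ , _ , _ , les _ L _ , ≡-refl) = neutral-¬abs ν (_ , _ , _ , L , ≡-refl)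

neutral-¬pair : 𝓝 t → ¬ PairLike t
neutral-¬pair var         (_ , _ , _ , □ , ())
neutral-¬pair var         (_ , _ , _ , les _ _ _ , ())
neutral-¬pair (app ν)     (_ , _ , _ , □ , ())
neutral-¬pair (app ν)     (_ , _ , _ , les _ _ _ , ())
neutral-¬pair (match ν _) (_ , _ , _ , les _ L _ , ≡-refl) = neutral-¬pair ν (_ , _ , _ , L , ≡-refl)

-- The outer matches form the list context; around a neutral body they yield a neutral term again.
canonical-shape : 𝓜 t → Abs t ⊎ PairLike t ⊎ 𝓝 t
canonical-shape (lam μ)     = inj₁ (_ , _ , _ , □ , ≡-refl)
canonical-shape pair        = inj₂ (inj₁ (_ , _ , _ , □ , ≡-refl))
canonical-shape (neutral ν) = inj₂ (inj₂ ν)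
canonical-shape (match μ ν) with canonical-shape μ
... | inj₁ (_ , _ , _ , L , ≡-refl)        = inj₁ (_ , _ , _ , les _ L _ , ≡-refl)
... | inj₂ (inj₁ (_ , _ , _ , L , ≡-refl)) = inj₂ (inj₁ (_ , _ , _ , les _ L _ , ≡-refl))
... | inj₂ (inj₂ ν′)                       = inj₂ (inj₂ (match ν′ ν))

neutral-irreducible : 𝓝 t → ¬ (∃[ k ] ∃[ v ] t ⟶⟨ k ⟩ v)
neutral-irreducible (app ν)      (_ , _ , β-b L p s eq)       = neutral-¬abs ν (_ , p , s , L , eq)
neutral-irreducible (app ν)      (_ , _ , ξ-app ρ _)          = neutral-irreducible ν (_ , _ , ρ)
neutral-irreducible (match _ ν)  (_ , _ , β-m L u₁ u₂ eq _)   = neutral-¬pair ν (_ , u₁ , u₂ , L , eq)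
neutral-irreducible (match ν _)  (_ , _ , ξ-l ρ)              = neutral-irreducible ν (_ , _ , ρ)
neutral-irreducible (match _ ν)  (_ , _ , ξ-r _ ρ)            = neutral-irreducible ν (_ , _ , ρ)

-- Provides the negative premises of `β-e`, `β-m` and `ξ-r`.
canonical-irreducible : 𝓜 t → ¬ (∃[ k ] ∃[ v ] t ⟶⟨ k ⟩ v)
canonical-irreducible (lam μ)     (_ , _ , ξ-lam ρ)            = canonical-irreducible μ (_ , _ , ρ)
canonical-irreducible (match _ ν) (_ , _ , β-m L u₁ u₂ eq _)   = neutral-¬pair ν (_ , u₁ , u₂ , L , eq)
canonical-irreducible (match μ _) (_ , _ , ξ-l ρ)              = canonical-irreducible μ (_ , _ , ρ)
canonical-irreducible (match _ ν) (_ , _ , ξ-r _ ρ)            = neutral-irreducible ν (_ , _ , ρ)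
canonical-irreducible (neutral ν) ρ                            = neutral-irreducible ν ρ

-- This lemma and the next four exclude clashes: read through the list context, a pair has only
-- product types and `tight •𝓜`, an abstraction only arrow types and `tight •𝓜`.
pair-¬neutral : PairLike t → ¬ (r ⊢ t ∶ tight •𝓝)
pair-¬neutral (_ , _ , _ , L , ≡-refl) d with replace-hole L d
... | _ , pair _ _ _ () , _

pair-¬arrow : PairLike t → ¬ (r ⊢ t ∶ A ⇒ σ)
pair-¬arrow (_ , _ , _ , L , ≡-refl) d with replace-hole L d
... | _ , pair _ _ _ () , _

abs-¬neutral : Abs t → ¬ (r ⊢ t ∶ tight •𝓝)
abs-¬neutral (_ , _ , _ , L , ≡-refl) d with replace-hole L d
... | _ , abs _ _ _ () , _

abs-¬product : Abs t → ¬ (r ⊢ t ∶ A ⊗ B)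
abs-¬product (_ , _ , _ , L , ≡-refl) d with replace-hole L d
... | _ , abs _ _ _ () , _

abs-¬pair-pattern : ∀ {p q Γ c} → Abs t → Γ ⊩[ c ] ⟨ p , q ⟩ᵖ ∶ A → ¬ (r ⊢* t ∶ A)
abs-¬pair-pattern α (pat-× _ _ eq) d = abs-¬product α (singleton* (≋-conv* (≋-sym eq) d))
abs-¬pair-pattern α (pat-p _ eq)   d = abs-¬neutral α (singleton* (≋-conv* (≋-sym eq) d))

Progress : Term n → Set
Progress t = 𝓜 t ⊎ (∃[ k ] ∃[ v ] t ⟶⟨ k ⟩ v)

app-progress : ∀ (t u : Term n) → Progress t → ¬ PairLike t → Progress (t · u)
app-progress t u φ ¬pair with abs? t | φ
-- Here (b) takes precedence: it fires even when `t` itself reduces, and `ξ-app` is then forbidden.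
... | yes (_ , p , s , L , eq) | _                = inj₂ (_ , _ , β-b L p s eq)
... | no ¬abs | inj₂ (_ , _ , ρ)                  = inj₂ (_ , _ , ξ-app ρ ¬abs)
... | no ¬abs | inj₁ μ with canonical-shape μ
...   | inj₁ α        = ⊥-elim (¬abs α)
...   | inj₂ (inj₁ π) = ⊥-elim (¬pair π)
...   | inj₂ (inj₂ ν) = inj₁ (neutral (app ν))

progress : r ⊢ t ∶ σ → Progress t
progress (ax _) = inj₁ (neutral var)
progress (abs d _ _ _) with progress d
... | inj₁ μ           = inj₁ (lam μ)
... | inj₂ (_ , _ , ρ) = inj₂ (_ , _ , ξ-lam ρ)
progress (abs-p d _ _) with progress d
... | inj₁ μ           = inj₁ (lam μ)
... | inj₂ (_ , _ , ρ) = inj₂ (_ , _ , ξ-lam ρ)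
progress (app d _ _)    = app-progress _ _ (progress d) λ π → pair-¬arrow π d
progress (app-p d _)    = app-progress _ _ (progress d) λ π → pair-¬neutral π d
progress (pair _ _ _ _) = inj₁ pair
progress (pair-p _)     = inj₁ pair
progress (match {pvar} d _ _ _) with progress d
... | inj₁ μ           = inj₂ (_ , _ , β-e (canonical-irreducible μ))
... | inj₂ (_ , _ , ρ) = inj₂ (_ , _ , ξ-l ρ)
progress (match {⟨ _ , _ ⟩ᵖ} d κ d′ _) with progress d
... | inj₂ (_ , _ , ρ) = inj₂ (_ , _ , ξ-l ρ)
... | inj₁ μ with pair-pattern-type κ
...   | _ , eq with ≋-conv* (≋-sym eq) d′
-- Having passed through `≋-conv*`, `dᵤ` is not a structural part of the given derivation; the
-- recursion descends on the term.
...     | cons dᵤ _ _ with progress dᵤ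
...       | inj₂ (_ , _ , ρ) = inj₂ (_ , _ , ξ-r (canonical-irreducible μ) ρ)
...       | inj₁ μ′ with canonical-shape μ′
...         | inj₁ α = ⊥-elim (abs-¬pair-pattern α κ d′)
...         | inj₂ (inj₁ (_ , u₁ , u₂ , L , eq′)) = inj₂ (_ , _ , β-m L u₁ u₂ eq′ (canonical-irreducible μ))
...         | inj₂ (inj₂ ν) = inj₁ (match μ ν)

-- Tight derivations of canonical forms

tight-∙ˡ : ∀ {X} {r s s′ : Resource X} → r ≈ s ∙ s′ → TightCtx (ctx r) → TightCtx (ctx s)
tight-∙ˡ {s = s} eq tgt x = ++⁻ˡ (ctx s x) (tightCtx-resp (ctx-≈ eq) tgt x)

tight-∙ʳ : ∀ {X} {r s s′ : Resource X} → r ≈ s ∙ s′ → TightCtx (ctx r) → TightCtx (ctx s′)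
tight-∙ʳ {s = s} eq tgt x = ++⁻ʳ (ctx s x) (tightCtx-resp (ctx-≈ eq) tgt x)

tight-match : ∀ p {c} {r s′ : Resource (Fin n)} {s} → r ≈ cost c ∙ (drop p s ∙ s′) → TightCtx (ctx r) →
              TightCtx (ctx s ∖ p) × TightCtx (ctx s′)
tight-match p {s′ = s′} {s} eq tgt =
  tight-∙ˡ {s = drop p s} {s′} ≈-refl (tight-∙ʳ eq tgt) , tight-∙ʳ {s = drop p s} {s′} ≈-refl (tight-∙ʳ eq tgt)

tight-binder : ∀ p (Γ : Ctx (Fin (n ▹ p))) → TightCtx (Γ ∖ p) → TightCtx (restrict p Γ) → TightCtx Γ
tight-binder pvar       Γ outer inner zero    = inner tt
tight-binder pvar       Γ outer inner (suc x) = outer x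
tight-binder ⟨ p , q ⟩ᵖ Γ outer inner =
  tight-binder p Γ (tight-binder q (Γ ∖ p) outer (inner ∘ inj₂)) (inner ∘ inj₁)

sized : ℕ → Count
sized = counts 0 0 0

sized-0 : ∀ i → 0 ≡ sized 0 i
sized-0 (step kb) = ≡-refl
sized-0 (step ke) = ≡-refl
sized-0 (step km) = ≡-refl
sized-0 size      = ≡-refl

sized-suc : ∀ {X} {r s : Resource X} {k} → r ≈ cost (tick size) ∙ s → (∀ i → cnt s i ≡ sized k i) →
            ∀ i → cnt r i ≡ sized (k + 1) i
sized-suc {k = k} eq eq′ i = ≡-trans (cnt-≈ eq i) (≡-trans (cong (tick size i +_) (eq′ i)) (≡-sym (counts-size 0 0 0 k i)))

-- The final 1 in the size of a match is the charge of its persistent pattern, which is why pattern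
-- and argument are counted together.
sized-match : ∀ {p c k l} {r s′ : Resource (Fin n)} {s : Resource (Fin (n ▹ p))} →
              r ≈ cost c ∙ (drop p s ∙ s′) → (∀ i → (c ⊕ cnt s′) i ≡ sized (l + 1) i) →
              (∀ i → cnt s i ≡ sized k i) → ∀ i → cnt r i ≡ sized (k + l + 1) i
sized-match {c = c} {k} {l} {s′ = s′} {s} eq eq₁ eq₂ i = ≡-trans (cnt-≈ eq i)
  (≡-trans (ℕ-Properties.x∙yz≈y∙xz (c i) (cnt s i) (cnt s′ i)) (≡-trans (cong₂ _+_ (eq₂ i) (eq₁ i)) (go i)))
  where
  go : ∀ i → sized k i + sized (l + 1) i ≡ sized (k + l + 1) i
  go (step kb) = ≡-refl
  go (step ke) = ≡-refl
  go (step km) = ≡-refl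
  go size      = ≡-sym (+-assoc k l 1)

-- On a neutral term tightness of the context spreads to the type, so under a
-- tight context a pair pattern matched against it can only be typed by pat-p.
mutual
  neutral-tight : 𝓝 t → r ⊢ t ∶ σ → TightCtx (ctx r) → Tight σ × (∀ i → cnt r i ≡ sized (∣ t ∣) i)
  neutral-tight var (ax {x} {σ} eq) tgt = go , λ i → ≡-trans (cnt-≈ eq i) (sized-0 i)
    where
    go : Tight σ
    go with x ≟ x | tightCtx-resp (ctx-≈ eq) tgt x
    ... | yes _  | τ ∷ [] = τ
    ... | no x≢x | _      = ⊥-elim (x≢x ≡-refl)
  neutral-tight (app ν) (app d _ eq) tgt with neutral-tight ν d (tight-∙ˡ eq tgt)
  ... | () , _
  neutral-tight (app ν) (app-p d eq) tgt with neutral-tight ν d (tight-∙ʳ eq tgt)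
  ... | _ , eq′ = tight •𝓝 , sized-suc eq eq′
  neutral-tight (match {p₁} {p₂} ν ν′) (match {s = s} d κ d′ eq) tgt with tight-match ⟨ p₁ , p₂ ⟩ᵖ eq tgt
  ... | tgtₛ , tgtᵤ with match-tight ν′ κ d′ tgtᵤ
  ... | tgtₚ , eq₁ with neutral-tight ν d (tight-binder ⟨ p₁ , p₂ ⟩ᵖ (ctx s) tgtₛ tgtₚ)
  ... | τ , eq₂ = τ , sized-match eq eq₁ eq₂

  match-tight : ∀ {p q Γ c} → 𝓝 u → Γ ⊩[ c ] ⟨ p , q ⟩ᵖ ∶ A → r ⊢* u ∶ A → TightCtx (ctx r) →
                TightCtx Γ × (∀ i → (c ⊕ cnt r) i ≡ sized (∣ u ∣ + 1) i)
  match-tight ν (pat-× _ _ eq) ds tgt with neutral-tight ν (singleton* (≋-conv* (≋-sym eq) ds)) tgt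
  ... | () , _
  match-tight {r = r} ν (pat-p tgtₚ eq) ds tgt =
    tgtₚ , sized-suc {s = r} ≈-refl (proj₂ (neutral-tight ν (singleton* (≋-conv* (≋-sym eq) ds)) tgt))

-- Abstractions and pairs can have arrow and product types even under a tight context, so tightness
-- of the type is assumed here; it leaves only `abs-p` and `pair-p` for them.
canonical-tight : 𝓜 t → r ⊢ t ∶ σ → TightCtx (ctx r) → Tight σ → ∀ i → cnt r i ≡ sized (∣ t ∣) i
canonical-tight (lam μ) (abs _ _ _ ()) tgt (tight _)
canonical-tight (lam {p} μ) (abs-p {s = s} d tgtₚ eq) tgt _ =
  sized-suc eq (canonical-tight μ d (tight-binder p (ctx s) (tight-∙ʳ eq tgt) tgtₚ) (tight _))
canonical-tight pair (pair _ _ _ ()) tgt (tight _)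
canonical-tight pair (pair-p eq) tgt _ = cnt-≈ eq
canonical-tight (match {p₁} {p₂} μ ν) (match {s = s} d κ d′ eq) tgt τ with tight-match ⟨ p₁ , p₂ ⟩ᵖ eq tgt
... | tgtₛ , tgtᵤ with match-tight ν κ d′ tgtᵤ
... | tgtₚ , eq₁ =
  sized-match eq eq₁
    (canonical-tight μ d (tight-binder ⟨ p₁ , p₂ ⟩ᵖ (ctx s) tgtₛ tgtₚ) τ)
canonical-tight (neutral ν) d tgt _ = proj₂ (neutral-tight ν d tgt)

-- Soundness

steps : Count → ℕ
steps c = c (step kb) + c (step ke) + c (step km)

steps-tick : ∀ {c d} k → (∀ i → c i ≡ (tick (step k) ⊕ d) i) → steps c ≡ suc (steps d)
steps-tick {d = d} k eq = ≡-trans (cong₂ _+_ (cong₂ _+_ (eq _) (eq _)) (eq _)) (go k)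
  where
  go : ∀ k → steps (tick (step k) ⊕ d) ≡ suc (steps d)
  go kb = ≡-refl
  go ke = cong (_+ d (step km)) (+-suc (d (step kb)) (d (step ke)))
  go km = +-suc (d (step kb) + d (step ke)) (d (step km))

Reduces : Term n → Count → Set
Reduces t c = ∃[ u ] 𝓜 u × (t ↠⟨ c (step kb) , c (step ke) , c (step km) ⟩ u) × ∣ u ∣ ≡ c size

reduces-conv : ∀ {c d} → (∀ i → c i ≡ d i) → Reduces t d → Reduces t c
reduces-conv eq ρ rewrite eq (step kb) | eq (step ke) | eq (step km) | eq size = ρ

reduces-step : ∀ {t u : Term n} {c} k → t ⟶⟨ k ⟩ u → Reduces u c → Reduces t (tick (step k) ⊕ c)
reduces-step kb ρ (v , μ , ρs , eq) = v , μ , step-b ρ ρs , eq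
reduces-step ke ρ (v , μ , ρs , eq) = v , μ , step-e ρ ρs , eq
reduces-step km ρ (v , μ , ρs , eq) = v , μ , step-m ρ ρs , eq

-- Subject reduction returns a derivation that is not a part of the old one, so the recursion is on
-- the number of steps still recorded in the counters.
tight-reduces : ∀ N → steps (cnt r) ≡ N → r ⊢ t ∶ σ → TightCtx (ctx r) → Tight σ → Reduces t (cnt r)
tight-reduces N eq d tgt τ with progress d
-- At a canonical form the step counters have been used up, so the empty sequence has the right
-- length and the remaining counter is the size.
... | inj₁ μ = reduces-conv (canonical-tight μ d tgt τ) (_ , μ , done , ≡-refl)
... | inj₂ (k , _ , ρ) with subject-reduction d ρ
tight-reduces zero eq d tgt τ | inj₂ (k , _ , ρ) | r′ , eq′ , d′
  with () ← ≡-trans (≡-sym eq) (steps-tick k (cnt-≈ eq′))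
tight-reduces (suc N) eq d tgt τ | inj₂ (k , _ , ρ) | r′ , eq′ , d′ =
  reduces-conv (cnt-≈ eq′) (reduces-step {c = cnt r′} k ρ
    (tight-reduces N (suc-injective (≡-trans (≡-sym (steps-tick k (cnt-≈ eq′))) eq)) d′ (tight-∙ʳ eq′ tgt) τ))

theorem2 : ∀ {n : ℕ} {Γ : Ctx (Fin n)} {b e m f : ℕ} {t : Term n} {σ : Ty} →
    Γ ⊢⟨ b , e , m , f ⟩ t ∶ σ → TightCtx Γ → Tight σ →
    ∃[ u ] (𝓜 u × (t ↠⟨ b , e , m ⟩ u) × ∣ u ∣ ≡ f)
theorem2 d tgt τ = tight-reduces _ ≡-refl (translate d) tgt τ
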